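{- Let $m,n,k,l$ be integers with $0\le l\le k\le m\le n$ and $m\ge 1$, and let $X_1,\ldots,X_m,Y_1,\ldots,Y_n$ be continuous, independent and identically distributed random variables with values in a totally ordered space $(\Omega,<)$. Then $$\Pr\left(X^{((m))}<_{k,l}Y^{((n))}\right)=\frac{\#(m,n,k,l)}{\binom{m+n}{m}},$$ where $\#(m,n,k,l)$ is the number of lattice paths from $(0,0)$ to $(m,n)$ with $k$-horizontal exceedance equal to $l$.
   Context: Order statistics: $X^{(i)}$ denotes the $i$-th smallest value among $X_1,\ldots,X_m$, and $Y^{(i)}$ the $i$-th smallest value among $Y_1,\ldots,Y_n$. $X^{((m))}$ denotes the chain $X^{(1)}<X^{(2)}<\cdots<X^{(m)}$, and similarly $Y^{((n))}$. By definition, $X^{((m))}<_{k,l}Y^{((n))}$ holds iff $|\{i : 1\le i\le k \text{ and } X^{(i)}<Y^{(i)}\}|=l$. "Continuous" means the common distribution has no atoms ($\Pr[X_1=\omega]=0$ for every $\omega\in\Omega$), so that ties among the variables have probability $0$; $\Omega$ carries a $\sigma$-algebra for which $\{(a,b):a<b\}$ is measurable in $\Omega\times\Omega$ (e.g. $\Omega=\mathbb{R}$ with the Borel $\sigma$-algebra). Lattice paths: a lattice path starts at $(0,0)$ and takes unit steps $(1,0)$ (horizontal edges) and $(0,1)$ (vertical edges). The $k$-horizontal exceedance of a path ending at $(m,n)$ is the number of its first $k$ horizontal edges that lie below the line $y=x$ (a horizontal edge from $(a-1,c)$ to $(a,c)$ lies below $y=x$ iff $c\le a-1$). -}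

module Defs where

open import Level using (0ℓ; Lift) renaming (suc to lsuc)
open import Algebra.Bundles using (CommutativeRing)
import Algebra.Definitions.RawMonoid as RawMonoid
open import Data.Bool.Base using (if_then_else_; _∧_)
open import Data.Fin.Base using (Fin; toℕ; inject≤; cast)
open import Data.List.Base using (List; []; _∷_; _++_; map; filter; length; lookup; tabulate; allFin)
open import Data.List.Properties using (length-tabulate)
open import Data.List.Membership.Propositional using (_∈_)
open import Data.List.Membership.Propositional.Properties using (∈-map⁺; ∈-map⁻; ∈-++⁺ˡ; ∈-++⁺ʳ)
open import Data.List.Relation.Binary.Permutation.Propositional.Properties using (↭-length)
open import Data.List.Relation.Unary.All using ([])
open import Data.List.Relation.Unary.Any using (here)
open import Data.List.Relation.Unary.AllPairs using ([]; _∷_)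
open import Data.List.Relation.Unary.Unique.Propositional using (Unique)
import Data.List.Relation.Unary.Unique.Propositional.Properties as Unique
import Data.List.Sort as Sort
open import Data.Nat.Base as ℕ using (ℕ; zero; suc; _<ᵇ_; _≤ᵇ_)
import Data.Nat.Properties as ℕ
open import Data.Product.Base using (_×_; _,_; ∃-syntax; uncurry)
open import Data.Unit.Polymorphic.Base using (⊤)
open import Data.Vec.Functional using (Vector)
open import Relation.Binary.Bundles using (StrictTotalOrder)
open import Relation.Binary.Core using (Rel)
open import Relation.Binary.Structures using (IsTotalOrder)
open import Relation.Binary.PropositionalEquality using (_≡_; _≢_; refl; sym; trans)
import Relation.Binary.Properties.StrictTotalOrder as STOProperties
open import Relation.Nullary using (¬_)
open import Relation.Unary using (Pred; _≐_; _∩_; ∁; ⋃; ⋂; _⊢_; _⟨×⟩_; Empty; Satisfiable)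

------------------------------------------------------------------------
-- The real numbers

-- The standard library has no type of real numbers; the reals are taken
-- to be a Dedekind-complete ordered field, which (classically) determines
-- them up to unique isomorphism.
-- As is usual for total division, x ⁻¹ is unconstrained at x ≈ 0#.

record CompleteOrderedField : Set₁ where
  infix  8 _⁻¹
  infixl 7 _/_
  infix  4 _≤_ _<_
  field
    commutativeRing : CommutativeRing 0ℓ 0ℓ

  open CommutativeRing commutativeRing public

  field
    _⁻¹           : Carrier → Carrier
    ⁻¹-cong       : ∀ {x y} → x ≈ y → x ⁻¹ ≈ y ⁻¹
    ⁻¹-inverseʳ   : ∀ {x} → x ≉ 0# → x * x ⁻¹ ≈ 1#
    0#≉1#         : 0# ≉ 1#
    _≤_           : Rel Carrier 0ℓ
    ≤-isTotalOrder : IsTotalOrder _≈_ _≤_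
    +-monoʳ-≤     : ∀ z {x y} → x ≤ y → z + x ≤ z + y
    *-nonNegative : ∀ {x y} → 0# ≤ x → 0# ≤ y → 0# ≤ x * y

  _IsUpperBoundOf_ : Carrier → Pred Carrier 0ℓ → Set
  b IsUpperBoundOf P = ∀ {x} → P x → x ≤ b

  field
    supremum : ∀ (P : Pred Carrier 0ℓ) → Satisfiable P → (∃[ b ] b IsUpperBoundOf P) →
               ∃[ s ] s IsUpperBoundOf P × (∀ {b} → b IsUpperBoundOf P → s ≤ b)

  _<_ : Rel Carrier 0ℓ
  x < y = x ≤ y × x ≉ y

  _/_ : Carrier → Carrier → Carrier
  x / y = x * y ⁻¹

  fromℕ : ℕ → Carrier
  fromℕ n = RawMonoid._×_ +-rawMonoid n 1#

  ∑ : ∀ {n} → Vector Carrier n → Carrier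
  ∑ = RawMonoid.sum +-rawMonoid

  ∏ : ∀ {n} → Vector Carrier n → Carrier
  ∏ = RawMonoid.sum *-rawMonoid

  _⟶_ : (ℕ → Carrier) → Carrier → Set
  f ⟶ x = ∀ {ε} → 0# < ε → ∃[ N ] ∀ n → N ℕ.≤ n → (x - ε < f n) × (f n < x + ε)

------------------------------------------------------------------------
-- σ-algebras

-- Measurability takes values one level up so that generated σ-algebras,
-- which quantify over all subsets, can be formed predicatively.

record σ-Algebra {u} (A : Set u) : Set (lsuc (lsuc u)) where
  field
    Measurable : Pred (Pred A u) (lsuc u)
    resp       : ∀ {P Q} → P ≐ Q → Measurable P → Measurable Q
    whole      : Measurable (λ _ → ⊤)
    complement : ∀ {P} → Measurable P → Measurable (∁ P)
    union      : ∀ {P : ℕ → Pred A u} → (∀ n → Measurable (P n)) → Measurable (⋃ ℕ P)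

data Generated {u} {A : Set u} (G : Pred (Pred A u) (lsuc u)) : Pred (Pred A u) (lsuc u) where
  gen-basic      : ∀ {P} → G P → Generated G P
  gen-resp       : ∀ {P Q} → P ≐ Q → Generated G P → Generated G Q
  gen-whole      : Generated G (λ _ → ⊤)
  gen-complement : ∀ {P} → Generated G P → Generated G (∁ P)
  gen-union      : ∀ {P : ℕ → Pred A u} → (∀ n → Generated G (P n)) → Generated G (⋃ ℕ P)

generatedBy : ∀ {u} {A : Set u} → Pred (Pred A u) (lsuc u) → σ-Algebra A
generatedBy G = record
  { Measurable = Generated G
  ; resp       = gen-resp
  ; whole      = gen-whole
  ; complement = gen-complement
  ; union      = gen-union
  }

module _ {u} {A B : Set u} (𝓐 : σ-Algebra A) (𝓑 : σ-Algebra B) where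

  private
    module 𝓐 = σ-Algebra 𝓐
    module 𝓑 = σ-Algebra 𝓑

  data Rectangle : Pred (Pred (A × B) u) (lsuc u) where
    rectangle : ∀ {P Q} → 𝓐.Measurable P → 𝓑.Measurable Q → Rectangle (P ⟨×⟩ Q)

  _⊗_ : σ-Algebra (A × B)
  _⊗_ = generatedBy Rectangle

record OrderedMeasurableSpace u : Set (lsuc (lsuc u)) where
  field
    strictTotalOrder : StrictTotalOrder u u u

  open StrictTotalOrder strictTotalOrder public

  field
    σ-algebra : σ-Algebra Carrier

  open σ-Algebra σ-algebra public using (Measurable)

  field
    <-measurable : σ-Algebra.Measurable (σ-algebra ⊗ σ-algebra) (uncurry _<_)

------------------------------------------------------------------------
-- Probability spaces

record ProbabilitySpace (ℝ : CompleteOrderedField) u : Set (lsuc (lsuc u)) where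
  open CompleteOrderedField ℝ using (_≈_; _≤_; 0#; 1#; ∑; _⟶_)
  field
    Outcome   : Set u
    σ-algebra : σ-Algebra Outcome

  open σ-Algebra σ-algebra public

  field
    Pr : ∀ (E : Pred Outcome u) → Measurable E → CompleteOrderedField.Carrier ℝ
    Pr-cong        : ∀ {E F} → E ≐ F → (mE : Measurable E) (mF : Measurable F) → Pr E mE ≈ Pr F mF
    Pr-nonNegative : ∀ {E} (mE : Measurable E) → 0# ≤ Pr E mE
    Pr-whole       : Pr (λ _ → ⊤) whole ≈ 1#
    Pr-σ-additive  : ∀ (E : ℕ → Pred Outcome u) (mE : ∀ n → Measurable (E n)) →
                     (∀ {i j} → i ≢ j → Empty (E i ∩ E j)) →
                     (λ n → ∑ {n} (λ i → Pr (E (toℕ i)) (mE (toℕ i)))) ⟶ Pr (⋃ ℕ E) (union mE)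

module _ {ℝ : CompleteOrderedField} {u} (𝒫 : ProbabilitySpace ℝ u) (Ω : OrderedMeasurableSpace u) where

  private
    module ℝ = CompleteOrderedField ℝ
    module 𝒫 = ProbabilitySpace 𝒫
    module Ω = OrderedMeasurableSpace Ω

  record RandomVariable : Set (lsuc u) where
    field
      value      : 𝒫.Outcome → Ω.Carrier
      measurable : ∀ {A} → Ω.Measurable A → 𝒫.Measurable (value ⊢ A)

    law : ∀ (A : Pred Ω.Carrier u) → Ω.Measurable A → ℝ.Carrier
    law A mA = 𝒫.Pr (value ⊢ A) (measurable mA)

open RandomVariable public

-- In the hypotheses `Continuous` and `Independent` below, the
-- measurability proofs that are quantified over always exist classically:
-- singletons are sections of the complement of {a < b} ∪ {b < a}, and
-- finite intersections come from complements and unions. By `Pr-cong`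
-- the probability does not depend on the proof.

module _ {ℝ : CompleteOrderedField} {u} {𝒫 : ProbabilitySpace ℝ u} {Ω : OrderedMeasurableSpace u} where

  private
    module ℝ = CompleteOrderedField ℝ
    module 𝒫 = ProbabilitySpace 𝒫
    module Ω = OrderedMeasurableSpace Ω

  Continuous : RandomVariable 𝒫 Ω → Set (lsuc u)
  Continuous Z = ∀ ω (mω : Ω.Measurable (Ω._≈ ω)) → law Z (Ω._≈ ω) mω ℝ.≈ ℝ.0#

  IdenticallyDistributed : ∀ {N} → Vector (RandomVariable 𝒫 Ω) N → Set (lsuc u)
  IdenticallyDistributed Z =
    ∀ i j A (mA : Ω.Measurable A) → law (Z i) A mA ℝ.≈ law (Z j) A mA

  Independent : ∀ {N} → Vector (RandomVariable 𝒫 Ω) N → Set (lsuc u)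
  Independent {N} Z =
    ∀ (A : Fin N → Pred Ω.Carrier u) (mA : ∀ i → Ω.Measurable (A i)) →
    ∀ (m⋂ : 𝒫.Measurable (⋂ (Fin N) (λ i → value (Z i) ⊢ A i))) →
    𝒫.Pr (⋂ (Fin N) (λ i → value (Z i) ⊢ A i)) m⋂ ℝ.≈ ℝ.∏ (λ i → law (Z i) (A i) (mA i))

------------------------------------------------------------------------
-- Order statistics

module _ {a ℓ₁ ℓ₂} (O : StrictTotalOrder a ℓ₁ ℓ₂) where

  open StrictTotalOrder O using (Carrier; _<?_)
  open Sort (STOProperties.decTotalOrder O) using (sort; sort-↭)

  -- Indices are 0-based: `orderStatistic x i` is the (toℕ i + 1)-th
  -- smallest of the values x, counted with multiplicity.

  orderStatistic : ∀ {n} → Vector Carrier n → Fin n → Carrier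
  orderStatistic x i = lookup (sort (tabulate x)) (cast n≡length i)
    where n≡length = sym (trans (↭-length (sort-↭ (tabulate x))) (length-tabulate x))

  countBelow : ∀ {m n} k → k ℕ.≤ m → k ℕ.≤ n → Vector Carrier m → Vector Carrier n → ℕ
  countBelow k k≤m k≤n x y =
    length (filter (λ i → orderStatistic x (inject≤ i k≤m) <? orderStatistic y (inject≤ i k≤n))
                   (allFin k))

-- The event X⁽⁽ᵐ⁾⁾ <ₖ,ₗ Y⁽⁽ⁿ⁾⁾.

ChainBelow : ∀ {ℝ u} {𝒫 : ProbabilitySpace ℝ u} {Ω : OrderedMeasurableSpace u} {m n}
             (k l : ℕ) → k ℕ.≤ m → k ℕ.≤ n →
             Vector (RandomVariable 𝒫 Ω) m → Vector (RandomVariable 𝒫 Ω) n →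
             Pred (ProbabilitySpace.Outcome 𝒫) u
ChainBelow {u = u} {Ω = Ω} k l k≤m k≤n X Y s =
  Lift u (countBelow (OrderedMeasurableSpace.strictTotalOrder Ω) k k≤m k≤n
            (λ i → value (X i) s) (λ j → value (Y j) s) ≡ l)

------------------------------------------------------------------------
-- Lattice paths

data Path : ℕ → ℕ → Set where
  start : Path 0 0
  right : ∀ {a c} → Path a c → Path (suc a) c
  up    : ∀ {a c} → Path a c → Path a (suc c)

-- The edge added by `right` runs from (a , c) to (suc a , c); it is the
-- (suc a)-th horizontal edge, and it lies below y = x iff c ≤ a.

exceedance : ∀ {m n} → ℕ → Path m n → ℕ
exceedance k start             = 0
exceedance k (right {a} {c} p) = (if (a <ᵇ k) ∧ (c ≤ᵇ a) then 1 else 0) ℕ.+ exceedance k p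
exceedance k (up p)            = exceedance k p

paths : ∀ m n → List (Path m n)
paths zero    zero    = start ∷ []
paths (suc m) zero    = map right (paths m zero)
paths zero    (suc n) = map up (paths zero n)
paths (suc m) (suc n) = map right (paths m (suc n)) ++ map up (paths (suc m) n)

-- `paths m n` lists every path exactly once, so that lengths of filtered
-- sublists are cardinalities.

paths-complete : ∀ {m n} (p : Path m n) → p ∈ paths m n
paths-complete start = here refl
paths-complete {suc m} {zero}  (right p) = ∈-map⁺ right (paths-complete p)
paths-complete {suc m} {suc n} (right p) = ∈-++⁺ˡ (∈-map⁺ right (paths-complete p))
paths-complete {zero}  {suc n} (up p)    = ∈-map⁺ up (paths-complete p)
paths-complete {suc m} {suc n} (up p)    =
  ∈-++⁺ʳ (map right (paths m (suc n))) (∈-map⁺ up (paths-complete p))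

private
  right-injective : ∀ {a c} {p q : Path a c} → right p ≡ right q → p ≡ q
  right-injective refl = refl

  up-injective : ∀ {a c} {p q : Path a c} → up p ≡ up q → p ≡ q
  up-injective refl = refl

  disjoint : ∀ {m n} {p : Path (suc m) (suc n)} (ps : List (Path m (suc n))) (qs : List (Path (suc m) n)) →
             ¬ (p ∈ map right ps × p ∈ map up qs)
  disjoint ps qs (p∈ , p∈′) with ∈-map⁻ right p∈ | ∈-map⁻ up p∈′
  ... | _ , _ , refl | _ , _ , ()

paths-unique : ∀ m n → Unique (paths m n)
paths-unique zero    zero    = [] ∷ []
paths-unique (suc m) zero    = Unique.map⁺ right-injective (paths-unique m zero)
paths-unique zero    (suc n) = Unique.map⁺ up-injective (paths-unique zero n)
paths-unique (suc m) (suc n) =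
  Unique.++⁺ (Unique.map⁺ right-injective (paths-unique m (suc n)))
             (Unique.map⁺ up-injective (paths-unique (suc m) n))
             (disjoint (paths m (suc n)) (paths (suc m) n))

#paths : ℕ → ℕ → ℕ → ℕ → ℕ
#paths m n k l = length (filter (λ p → exceedance k p ℕ.≟ l) (paths m n))

{-# OPTIONS --safe #-}

-- For distinct values z₁, …, z_{m+n}, splitting them into m X's and n Y's along a
-- lattice path read off the sorted values turns |{i ≤ k : X⁽ⁱ⁾ < Y⁽ⁱ⁾}| into the
-- k-horizontal exceedance of that path, so exactly #(m,n,k,l) of the C(m+n,m) splits
-- realise the event. This number of splits does not depend on the order in which the
-- values are listed. The law of the sample is invariant under permutations, so all
-- splits realise the event with the same probability p; summing over the splits gives
-- C(m+n,m) p = #(m,n,k,l), provided that ties have probability 0.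
--
-- Permutation invariance holds for boxes by independence, hence for Boolean
-- combinations of the cylinders {zᵢ ∈ P}, and passes to all measurable sets by
-- approximation. Ties are null because the set {x ≈ y} in the plane is measurable and
-- has null sections, by the following substitute for Fubini's theorem. For such a
-- set S there are finite unions of rectangles Kₙ that decrease to a subset of S and each
-- cover S up to a set of small probability. For every b the section of Kₙ at b has small
-- probability for large n, hence so do the sections of one Kₙ at all b outside a set
-- of small probability; for finite unions of rectangles this bounds the probability.

module Submission where

open import Defs
open import Level using (Lift; lift; lower) renaming (suc to lsuc)
import Algebra.Properties.AbelianGroup as AbelianGroupProperties
import Algebra.Properties.CommutativeMonoid.Sum as CommutativeMonoidSum
import Algebra.Properties.CommutativeSemigroup as CommutativeSemigroupProperties
import Algebra.Properties.Ring as RingProperties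
open import Axiom.ExcludedMiddle using (ExcludedMiddle)
open import Data.Bool.Base using (Bool; true; false; if_then_else_; _∧_; _∨_)
open import Data.Bool.Properties using (∧-zeroʳ)
open import Data.Empty using (⊥-elim)
open import Data.Empty.Polymorphic using (⊥)
open import Data.Fin.Base as Fin using (Fin; toℕ; inject≤; zero; suc; _↑ˡ_; _↑ʳ_)
open import Data.Fin.Permutation as Perm using (Permutation; _⟨$⟩ʳ_; _⟨$⟩ˡ_; inverseʳ; inverseˡ)
import Data.Fin.Properties as Fin
open import Data.List.Base as List using (List; []; _∷_; map; filter; length; lookup; tabulate; allFin)
open import Data.List.Membership.Propositional using (_∈_; find; lose)
open import Data.List.Membership.Propositional.Properties using (∈-lookup; ∈-length)
open import Data.List.Properties
  using (filter-all; filter-none; filter-accept; filter-reject; filter-≐; length-tabulate; length-filter;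
         length-map; length-++; map-∘; map-++; map-cong; map-tabulate; tabulate-cong)
open import Data.List.Relation.Binary.Permutation.Propositional as ↭ using (_↭_; ↭-sym; ↭-refl; ↭⇒↭ₛ)
open import Data.List.Relation.Binary.Permutation.Propositional.Properties using (↭-length; filter-↭; ∈-resp-↭)
import Data.List.Relation.Binary.Permutation.Setoid.Properties as ↭ₛ
open import Data.List.Relation.Binary.Sublist.Propositional using ([]; _∷_; _∷ʳ_; minimum) renaming (_⊆_ to _⊆ˡ_)
open import Data.List.Relation.Binary.Sublist.Propositional.Properties using (All-resp-⊆)
open import Data.List.Relation.Unary.All as All using (All; []; _∷_)
open import Data.List.Relation.Unary.AllPairs as AllPairs using (AllPairs; []; _∷_)
import Data.List.Relation.Unary.AllPairs.Properties as AllPairs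
open import Data.List.Relation.Unary.Any using (Any; here; there; any?)
import Data.List.Relation.Unary.Any.Properties as Any
open import Data.List.Relation.Unary.Sorted.TotalOrder.Properties using (Sorted⇒AllPairs)
import Data.List.Sort as Sort
open import Data.Nat.Base as ℕ using (ℕ; zero; suc; z≤n; s≤s; z<s; s<s; _⊔_; _≡ᵇ_; _<ᵇ_)
open import Data.Nat.Combinatorics using (_C_; nCk+nC[k+1]≡[n+1]C[k+1]; nCn≡1; nCk≡nC[n∸k])
open import Data.Nat.ListAction using (sum)
open import Data.Nat.ListAction.Properties using (sum-++)
import Data.Nat.Properties as ℕ
open import Data.Product.Base using (_×_; _,_; ∃-syntax; Σ-syntax; proj₁; proj₂; uncurry; swap)
open import Data.Sum.Base as Sum using (_⊎_; inj₁; inj₂; [_,_]′)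
open import Data.Unit.Polymorphic.Base using (⊤; tt)
open import Data.Vec.Functional using (Vector; _++_)
open import Data.Vec.Functional.Properties using (lookup-++ˡ; lookup-++ʳ)
open import Function.Base using (_∘_; id; flip)
open import Function.Bundles using (_⇔_; mk⇔; mk↔ₛ′; Equivalence)
open import Function.Construct.Composition using (_↔-∘_)
open import Relation.Binary.Bundles using (StrictTotalOrder; DecTotalOrder; Poset)
import Relation.Binary.Construct.Flip.EqAndOrd as Flip
open import Relation.Binary.Core using (Rel; _⇒_)
open import Relation.Binary.Definitions using (Symmetric; _Respects_; tri<; tri≈; tri>)
open import Relation.Binary.PropositionalEquality as ≡ using (_≡_; _≢_; _≗_; refl; module ≡-Reasoning)
import Relation.Binary.Properties.StrictTotalOrder as STOProperties
import Relation.Binary.Reasoning.PartialOrder as PosetReasoning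
open import Relation.Binary.Structures using (IsTotalOrder)
open import Relation.Nullary using (¬_; Dec; yes; no; does; contradiction)
open import Relation.Nullary.Decidable using (does-⇔; _×-dec_; _⊎-dec_; dec-false; decidable-stable)
open import Relation.Unary
  using (Pred; Decidable; Empty; Satisfiable; _⊆_; _≐_; _∩_; _∪_; _⊢_; ∁; ⋃; ⋂)

-- Equality of two laws passes to complements and to disjoint unions, whereas induction over
-- `Generated` meets arbitrary countable unions. The property carried through that induction must
-- therefore be stronger than equality of laws, and approximation by formulas is one that survives
-- every constructor. Integrals are avoided throughout: measurability in b of the law of a section
-- is only ever used for formulas, where this law takes finitely many values, and the expected
-- number of successful splits is a finite sum of probabilities that is evaluated in two ways.
-- Sorting is an obstacle both to the combinatorics and to measurability. It is removed by ranks,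
-- the numbers of entries at most a given value: they do not change under permutations, they depend
-- only on comparisons between coordinates, and they make sense for lists of any length, as an
-- induction along a path requires.

private
  module ℕ+ = CommutativeSemigroupProperties ℕ.+-commutativeSemigroup

-- Counting

indicator : Bool → ℕ
indicator b = if b then 1 else 0

count : (ℕ → Bool) → ℕ → ℕ
count b zero    = 0
count b (suc k) = indicator (b 0) ℕ.+ count (b ∘ suc) k

count-cong : ∀ {b c} → b ≗ c → count b ≗ count c
count-cong b≗c zero    = refl
count-cong b≗c (suc k) = ≡.cong₂ (λ x → indicator x ℕ.+_) (b≗c 0) (count-cong (b≗c ∘ suc) k)

-- Position `a`, off in `c`, is set to `d`, which is seen only if `a` is among the first `k`
-- positions. The increment has the form of the contribution of a horizontal edge to `exceedance`.
count-insert : ∀ {b c : ℕ → Bool} a d k → c a ≡ false → (∀ t → b t ≡ (t ≡ᵇ a) ∧ d ∨ c t) →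
               count b k ≡ indicator ((a <ᵇ k) ∧ d) ℕ.+ count c k
count-insert a       d zero    ca b≗ = refl
count-insert zero    d (suc k) ca b≗ rewrite b≗ 0 | ca with d
... | true  = ≡.cong suc (count-cong (b≗ ∘ suc) k)
... | false = count-cong (b≗ ∘ suc) k
count-insert {b} {c} (suc a) d (suc k) ca b≗ rewrite b≗ 0 = ≡.trans
  (≡.cong (indicator (c 0) ℕ.+_) (count-insert a d k ca (b≗ ∘ suc)))
  (ℕ+.x∙yz≈y∙xz (indicator (c 0)) (indicator ((a <ᵇ k) ∧ d)) (count (c ∘ suc) k))

length-filter-tabulate : ∀ {i p} {I : Set i} {P : Pred I p} (P? : Decidable P) b {k} (f : Fin k → I) →
                         (∀ t → does (P? (f t)) ≡ b (toℕ t)) → length (filter P? (tabulate f)) ≡ count b k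
length-filter-tabulate P? b {zero}  f eq = refl
length-filter-tabulate P? b {suc k} f eq
  with does (P? (f zero)) | eq zero | length-filter-tabulate P? (b ∘ suc) (f ∘ suc) (eq ∘ suc)
... | true  | e | ih rewrite ≡.sym e = ≡.cong suc ih
... | false | e | ih rewrite ≡.sym e = ih

length-filter≡sum : ∀ {i p} {I : Set i} {P : Pred I p} (P? : Decidable P) xs →
                    length (filter P? xs) ≡ sum (map (indicator ∘ does ∘ P?) xs)
length-filter≡sum P? []       = refl
length-filter≡sum P? (x ∷ xs) with does (P? x)
... | true  = ≡.cong suc (length-filter≡sum P? xs)
... | false = length-filter≡sum P? xs

pred-+-suc : ∀ a c {N} → suc N ≡ a ℕ.+ suc c → N ≡ a ℕ.+ c
pred-+-suc a c eq = ℕ.suc-injective (≡.trans eq (ℕ.+-suc a c))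

-- Splitting a list along a path

-- The head of the list goes with the last step of the path.

module _ {a} {A : Set a} where

  dealX dealY : ∀ {m n} → Path m n → List A → List A
  dealX p         []       = []
  dealX start     (z ∷ zs) = []
  dealX (right p) (z ∷ zs) = z ∷ dealX p zs
  dealX (up p)    (z ∷ zs) = dealX p zs
  dealY p         []       = []
  dealY start     (z ∷ zs) = []
  dealY (right p) (z ∷ zs) = dealY p zs
  dealY (up p)    (z ∷ zs) = z ∷ dealY p zs

  dealX-⊆ : ∀ {m n} (p : Path m n) zs → dealX p zs ⊆ˡ zs
  dealX-⊆ p         []       = []
  dealX-⊆ start     (z ∷ zs) = z ∷ʳ minimum zs
  dealX-⊆ (right p) (z ∷ zs) = refl ∷ dealX-⊆ p zs
  dealX-⊆ (up p)    (z ∷ zs) = z ∷ʳ dealX-⊆ p zs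

  dealY-⊆ : ∀ {m n} (p : Path m n) zs → dealY p zs ⊆ˡ zs
  dealY-⊆ p         []       = []
  dealY-⊆ start     (z ∷ zs) = z ∷ʳ minimum zs
  dealY-⊆ (right p) (z ∷ zs) = z ∷ʳ dealY-⊆ p zs
  dealY-⊆ (up p)    (z ∷ zs) = refl ∷ dealY-⊆ p zs

  length-dealX : ∀ {m n} (p : Path m n) zs → length zs ≡ m ℕ.+ n → length (dealX p zs) ≡ m
  length-dealX start             []       eq = refl
  length-dealX (up {a} {c} p)    []       eq = contradiction (≡.trans eq (ℕ.+-suc a c)) λ ()
  length-dealX (right p)         (z ∷ zs) eq = ≡.cong suc (length-dealX p zs (ℕ.suc-injective eq))
  length-dealX (up {a} {c} p)    (z ∷ zs) eq = length-dealX p zs (pred-+-suc a c eq)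

  length-dealY : ∀ {m n} (p : Path m n) zs → length zs ≡ m ℕ.+ n → length (dealY p zs) ≡ n
  length-dealY start             []       eq = refl
  length-dealY (up {a} {c} p)    []       eq = contradiction (≡.trans eq (ℕ.+-suc a c)) λ ()
  length-dealY (right p)         (z ∷ zs) eq = length-dealY p zs (ℕ.suc-injective eq)
  length-dealY (up {a} {c} p)    (z ∷ zs) eq = ≡.cong suc (length-dealY p zs (pred-+-suc a c eq))

  AllPairs-resp-⊆ : ∀ {r} {R : Rel A r} {xs ys} → xs ⊆ˡ ys → AllPairs R ys → AllPairs R xs
  AllPairs-resp-⊆ []         []       = []
  AllPairs-resp-⊆ (y ∷ʳ τ)   (_ ∷ ps) = AllPairs-resp-⊆ τ ps
  AllPairs-resp-⊆ (refl ∷ τ) (p ∷ ps) = All-resp-⊆ τ p ∷ AllPairs-resp-⊆ τ ps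

  splitSum : (List A → List A → ℕ) → List A → ℕ
  splitSum F []       = F [] []
  splitSum F (z ∷ zs) = splitSum (λ xs → F (z ∷ xs)) zs ℕ.+ splitSum (λ xs ys → F xs (z ∷ ys)) zs

  splitSum-cong : ∀ {F G} → (∀ xs ys → F xs ys ≡ G xs ys) → ∀ zs → splitSum F zs ≡ splitSum G zs
  splitSum-cong eq []       = eq [] []
  splitSum-cong eq (z ∷ zs) =
    ≡.cong₂ ℕ._+_ (splitSum-cong (λ xs → eq (z ∷ xs)) zs) (splitSum-cong (λ xs ys → eq xs (z ∷ ys)) zs)

  splitSum-zero : ∀ {F} → (∀ xs ys → F xs ys ≡ 0) → ∀ zs → splitSum F zs ≡ 0
  splitSum-zero eq []       = eq [] []
  splitSum-zero eq (z ∷ zs) =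
    ≡.cong₂ ℕ._+_ (splitSum-zero (λ xs → eq (z ∷ xs)) zs) (splitSum-zero (λ xs ys → eq xs (z ∷ ys)) zs)

  Invariant : (List A → List A → ℕ) → Set a
  Invariant F = ∀ {xs xs′ ys ys′} → xs ↭ xs′ → ys ↭ ys′ → F xs ys ≡ F xs′ ys′

  -- Under a transposition of the first two entries, the splits that separate them change places.
  -- The splits that keep them together are matched by the invariance of `F` within one part.
  splitSum-↭ : ∀ {F} → Invariant F → ∀ {zs zs′} → zs ↭ zs′ → splitSum F zs ≡ splitSum F zs′
  splitSum-↭ F-inv ↭.refl        = refl
  splitSum-↭ F-inv (↭.prep z p)  =
    ≡.cong₂ ℕ._+_ (splitSum-↭ (F-inv ∘ ↭.prep z) p) (splitSum-↭ (λ q → F-inv q ∘ ↭.prep z) p)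
  splitSum-↭ F-inv (↭.trans p q) = ≡.trans (splitSum-↭ F-inv p) (splitSum-↭ F-inv q)
  splitSum-↭ {F} F-inv {x ∷ y ∷ zs} {_ ∷ _ ∷ zs′} (↭.swap x y p) = ≡.trans
    (≡.cong₂ ℕ._+_ (≡.cong₂ ℕ._+_ both-left (splitSum-↭ (λ q r → F-inv (↭.prep x q) (↭.prep y r)) p))
                   (≡.cong₂ ℕ._+_ (splitSum-↭ (λ q r → F-inv (↭.prep y q) (↭.prep x r)) p) both-right))
    (ℕ+.interchange (splitSum (λ xs → F (y ∷ x ∷ xs)) zs′) (splitSum (λ xs ys → F (x ∷ xs) (y ∷ ys)) zs′)
                    (splitSum (λ xs ys → F (y ∷ xs) (x ∷ ys)) zs′) (splitSum (λ xs ys → F xs (y ∷ x ∷ ys)) zs′))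
    where
    both-left : splitSum (λ xs → F (x ∷ y ∷ xs)) zs ≡ splitSum (λ xs → F (y ∷ x ∷ xs)) zs′
    both-left = ≡.trans (splitSum-cong (λ _ _ → F-inv (↭.swap x y ↭-refl) ↭-refl) zs)
                        (splitSum-↭ (F-inv ∘ ↭.prep y ∘ ↭.prep x) p)
    both-right : splitSum (λ xs ys → F xs (x ∷ y ∷ ys)) zs ≡ splitSum (λ xs ys → F xs (y ∷ x ∷ ys)) zs′
    both-right = ≡.trans (splitSum-cong (λ _ _ → F-inv ↭-refl (↭.swap x y ↭-refl)) zs)
                         (splitSum-↭ (λ q → F-inv q ∘ ↭.prep y ∘ ↭.prep x) p)

  pathSum : ∀ m n → (List A → List A → ℕ) → List A → ℕ
  pathSum m n F zs = sum (map (λ p → F (dealX p zs) (dealY p zs)) (paths m n))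

  -- Summing over splits of all sizes, with the unwanted ones weighted 0, spares
  -- the proof of permutation invariance a case distinction on m and n.

  ofSizes : ℕ → ℕ → (List A → List A → ℕ) → List A → List A → ℕ
  ofSizes m n F xs ys = if (length ys ≡ᵇ n) ∧ (length xs ≡ᵇ m) then F xs ys else 0

  ofSizes-invariant : ∀ m n {F} → Invariant F → Invariant (ofSizes m n F)
  ofSizes-invariant m n F-inv p q rewrite ↭-length p | ↭-length q | F-inv p q = refl

  -- `paths` and `splitSum` branch alike, and `≡ᵇ` strips a successor from the size of the part that
  -- receives the head. Where one coordinate is 0, only one last step is possible, and the other
  -- branch of `splitSum` has weight 0.
  pathSum≡splitSum : ∀ m n F zs → length zs ≡ m ℕ.+ n → pathSum m n F zs ≡ splitSum (ofSizes m n F) zs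
  pathSum≡splitSum zero    zero    F []       eq = ℕ.+-identityʳ _
  pathSum≡splitSum (suc m) zero    F (z ∷ zs) eq = begin
    sum (map _ (map right (paths m 0)))               ≡⟨ ≡.cong sum (≡.sym (map-∘ (paths m 0))) ⟩
    pathSum m 0 (λ xs → F (z ∷ xs)) zs                ≡⟨ pathSum≡splitSum m 0 _ zs (ℕ.suc-injective eq) ⟩
    splitSum (ofSizes m 0 (λ xs → F (z ∷ xs))) zs     ≡⟨ ℕ.+-identityʳ _ ⟨
    splitSum (ofSizes m 0 (λ xs → F (z ∷ xs))) zs ℕ.+ 0
      ≡⟨ ≡.cong (splitSum (ofSizes m 0 (λ xs → F (z ∷ xs))) zs ℕ.+_) (splitSum-zero (λ _ _ → refl) zs) ⟨
    splitSum (ofSizes (suc m) 0 F) (z ∷ zs)           ∎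
    where open ≡-Reasoning
  pathSum≡splitSum zero    (suc n) F (z ∷ zs) eq = begin
    sum (map _ (map up (paths 0 n)))                      ≡⟨ ≡.cong sum (≡.sym (map-∘ (paths 0 n))) ⟩
    pathSum 0 n (λ xs ys → F xs (z ∷ ys)) zs              ≡⟨ pathSum≡splitSum 0 n _ zs (ℕ.suc-injective eq) ⟩
    splitSum (ofSizes 0 n (λ xs ys → F xs (z ∷ ys))) zs
      ≡⟨ ≡.cong (ℕ._+ splitSum (ofSizes 0 n (λ xs ys → F xs (z ∷ ys))) zs) (splitSum-zero no-x zs) ⟨
    splitSum (ofSizes 0 (suc n) F) (z ∷ zs)               ∎
    where
    open ≡-Reasoning
    no-x : ∀ xs ys → ofSizes 0 (suc n) F (z ∷ xs) ys ≡ 0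
    no-x xs ys = ≡.cong (λ b → if b then F (z ∷ xs) ys else 0) (∧-zeroʳ (length ys ≡ᵇ suc n))
  pathSum≡splitSum (suc m) (suc n) F (z ∷ zs) eq = begin
    sum (map f (map right (paths m (suc n)) List.++ map up (paths (suc m) n)))
      ≡⟨ ≡.cong sum (map-++ f (map right (paths m (suc n))) _) ⟩
    sum (map f (map right (paths m (suc n))) List.++ map f (map up (paths (suc m) n)))
      ≡⟨ sum-++ (map f (map right (paths m (suc n)))) _ ⟩
    sum (map f (map right (paths m (suc n)))) ℕ.+ sum (map f (map up (paths (suc m) n)))
      ≡⟨ ≡.cong₂ (λ u v → sum u ℕ.+ sum v) (≡.sym (map-∘ (paths m (suc n)))) (≡.sym (map-∘ (paths (suc m) n))) ⟩
    pathSum m (suc n) (λ xs → F (z ∷ xs)) zs ℕ.+ pathSum (suc m) n (λ xs ys → F xs (z ∷ ys)) zs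
      ≡⟨ ≡.cong₂ ℕ._+_ (pathSum≡splitSum m (suc n) _ zs (ℕ.suc-injective eq))
                   (pathSum≡splitSum (suc m) n _ zs (ℕ.suc-injective (≡.trans eq (ℕ.+-suc (suc m) n)))) ⟩
    splitSum (ofSizes (suc m) (suc n) F) (z ∷ zs) ∎
    where
    open ≡-Reasoning
    f : Path (suc m) (suc n) → ℕ
    f p = F (dealX p (z ∷ zs)) (dealY p (z ∷ zs))

  pathSum-↭ : ∀ m n {F} → Invariant F → ∀ {zs zs′} → length zs ≡ m ℕ.+ n → zs ↭ zs′ →
              pathSum m n F zs ≡ pathSum m n F zs′
  pathSum-↭ m n {F} F-inv {zs} {zs′} eq p = begin
    pathSum m n F zs              ≡⟨ pathSum≡splitSum m n F zs eq ⟩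
    splitSum (ofSizes m n F) zs   ≡⟨ splitSum-↭ (ofSizes-invariant m n F-inv) p ⟩
    splitSum (ofSizes m n F) zs′  ≡⟨ pathSum≡splitSum m n F zs′ (≡.trans (≡.sym (↭-length p)) eq) ⟨
    pathSum m n F zs′             ∎
    where open ≡-Reasoning

-- A witness that `paths m n` is nonempty, from which the binomial coefficient in the denominator is
-- nonzero.
somePath : ∀ m n → Path m n
somePath zero    zero    = start
somePath (suc m) n       = right (somePath m n)
somePath zero    (suc n) = up (somePath zero n)

length-paths : ∀ m n → length (paths m n) ≡ (m ℕ.+ n) C m
length-paths zero    zero    = refl
length-paths (suc m) zero    = begin
  length (map right (paths m 0)) ≡⟨ length-map right (paths m 0) ⟩
  length (paths m 0)             ≡⟨ length-paths m 0 ⟩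
  (m ℕ.+ 0) C m                  ≡⟨ ≡.cong (_C m) (ℕ.+-identityʳ m) ⟩
  m C m                          ≡⟨ nCn≡1 m ⟩
  1                              ≡⟨ nCn≡1 (suc m) ⟨
  suc m C suc m                  ≡⟨ ≡.cong (λ k → suc k C suc m) (ℕ.+-identityʳ m) ⟨
  suc (m ℕ.+ 0) C suc m          ∎
  where open ≡-Reasoning
length-paths zero    (suc n) = begin
  length (map up (paths 0 n)) ≡⟨ length-map up (paths 0 n) ⟩
  length (paths 0 n)          ≡⟨ length-paths 0 n ⟩
  n C 0                       ≡⟨ ≡.trans (nC0≡1 n) (≡.sym (nC0≡1 (suc n))) ⟩
  suc n C 0                   ∎
  where
  open ≡-Reasoning
  nC0≡1 : ∀ n → n C 0 ≡ 1
  nC0≡1 n = ≡.trans (nCk≡nC[n∸k] {0} {n} z≤n) (nCn≡1 n)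
length-paths (suc m) (suc n) = begin
  length (map right (paths m (suc n)) List.++ map up (paths (suc m) n))
    ≡⟨ length-++ (map right (paths m (suc n))) ⟩
  length (map right (paths m (suc n))) ℕ.+ length (map up (paths (suc m) n))
    ≡⟨ ≡.cong₂ ℕ._+_ (length-map right (paths m (suc n))) (length-map up (paths (suc m) n)) ⟩
  length (paths m (suc n)) ℕ.+ length (paths (suc m) n)
    ≡⟨ ≡.cong₂ ℕ._+_ (length-paths m (suc n)) (length-paths (suc m) n) ⟩
  (m ℕ.+ suc n) C m ℕ.+ (suc m ℕ.+ n) C suc m
    ≡⟨ ≡.cong (λ k → (m ℕ.+ suc n) C m ℕ.+ k C suc m) (≡.sym (ℕ.+-suc m n)) ⟩
  (m ℕ.+ suc n) C m ℕ.+ (m ℕ.+ suc n) C suc m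
    ≡⟨ nCk+nC[k+1]≡[n+1]C[k+1] (m ℕ.+ suc n) m ⟩
  suc (m ℕ.+ suc n) C suc m ∎
  where open ≡-Reasoning

-- Order statistics through ranks

module OrderStatistics {a ℓ₁ ℓ₂} (O : StrictTotalOrder a ℓ₁ ℓ₂) where

  open StrictTotalOrder O using (Carrier; _≈_; _<_; _<?_; compare; module Eq)
    renaming (trans to <-trans; irrefl to <-irrefl)
  private
    DO = STOProperties.decTotalOrder O
  open DecTotalOrder DO using (_≤_; _≤?_) renaming (trans to ≤-trans; refl to ≤-refl)
  open Sort DO using (sort; sort-↭; sort-↗)

  <⇒≱ : ∀ {x y} → x < y → ¬ y ≤ x
  <⇒≱ x<y (inj₁ y<x) = <-irrefl Eq.refl (<-trans x<y y<x)
  <⇒≱ x<y (inj₂ y≈x) = <-irrefl (Eq.sym y≈x) x<y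

  ≰⇒> : ∀ {x y} → ¬ x ≤ y → y < x
  ≰⇒> {x} {y} x≰y with compare x y
  ... | tri< x<y _ _ = contradiction (inj₁ x<y) x≰y
  ... | tri≈ _ x≈y _ = contradiction (inj₂ x≈y) x≰y
  ... | tri> _ _ y<x = y<x

  rank : Carrier → List Carrier → ℕ
  rank v xs = length (filter (_≤? v) xs)

  rank-↭ : ∀ v {xs ys} → xs ↭ ys → rank v xs ≡ rank v ys
  rank-↭ v p = ↭-length (filter-↭ (_≤? v) p)

  -- In a sorted list the entries at most `v` form an initial segment, whose length is the rank of
  -- `v`.
  lookup-≤ : ∀ {L} → AllPairs _≤_ L → ∀ v i → lookup L i ≤ v ⇔ toℕ i ℕ.< rank v L
  lookup-≤ {x ∷ L} (x≤L ∷ L↗) v i with x ≤? v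
  lookup-≤ {x ∷ L} (x≤L ∷ L↗) v zero    | yes x≤v = mk⇔ (λ _ → z<s) (λ _ → x≤v)
  lookup-≤ {x ∷ L} (x≤L ∷ L↗) v (suc i) | yes x≤v = mk⇔ (s<s ∘ to) (from ∘ ℕ.s<s⁻¹)
    where open Equivalence (lookup-≤ L↗ v i)
  ... | no x≰v rewrite filter-none (_≤? v) (All.map (λ x≤y y≤v → x≰v (≤-trans x≤y y≤v)) x≤L) =
    mk⇔ (λ Li≤v → contradiction (≤-trans (All.lookup (≤-refl ∷ x≤L) (∈-lookup i)) Li≤v) x≰v) λ ()

  orderStatistic-≤ : ∀ {n} (x : Vector Carrier n) v i →
                     orderStatistic O x i ≤ v ⇔ toℕ i ℕ.< rank v (tabulate x)
  orderStatistic-≤ x v i = ≡.subst (λ r → orderStatistic O x i ≤ v ⇔ r)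
    (≡.cong₂ ℕ._<_ (Fin.toℕ-cast _ i) (rank-↭ v (sort-↭ (tabulate x))))
    (lookup-≤ (Sorted⇒AllPairs (DecTotalOrder.totalOrder DO) (sort-↗ (tabulate x))) v _)

  orderStatistic-∈ : ∀ {n} (x : Vector Carrier n) i → orderStatistic O x i ∈ tabulate x
  orderStatistic-∈ x i = ∈-resp-↭ (sort-↭ (tabulate x)) (∈-lookup _)

  -- A form of X⁽ᵗ⁺¹⁾ < Y⁽ᵗ⁺¹⁾ that does not refer to sorting and is correct in the
  -- presence of ties: an x with X⁽ᵗ⁺¹⁾ ≤ x < Y⁽ᵗ⁺¹⁾ exists iff X⁽ᵗ⁺¹⁾ is one.

  Below : ℕ → List Carrier → List Carrier → Set a
  Below t xs ys = Any (λ x → t ℕ.< rank x xs × rank x ys ℕ.≤ t) xs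

  below? : ∀ t xs ys → Dec (Below t xs ys)
  below? t xs ys = any? (λ x → (t ℕ.<? rank x xs) ×-dec (rank x ys ℕ.≤? t)) xs

  orderStatistic-< : ∀ {m n} (x : Vector Carrier m) (y : Vector Carrier n) i j → toℕ i ≡ toℕ j →
                     orderStatistic O x i < orderStatistic O y j ⇔ Below (toℕ i) (tabulate x) (tabulate y)
  orderStatistic-< x y i j i≡j = mk⇔ to from
    where
    xᵢ = orderStatistic O x i
    yⱼ = orderStatistic O y j
    module X v = Equivalence (orderStatistic-≤ x v i)
    module Y v = Equivalence (orderStatistic-≤ y v j)
    to : xᵢ < yⱼ → Below (toℕ i) (tabulate x) (tabulate y)
    to xᵢ<yⱼ = lose (orderStatistic-∈ x i)
      (X.to xᵢ ≤-refl , ℕ.≮⇒≥ λ i< → <⇒≱ xᵢ<yⱼ (Y.from xᵢ (≡.subst (ℕ._< rank xᵢ (tabulate y)) i≡j i<)))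
    from : Below (toℕ i) (tabulate x) (tabulate y) → xᵢ < yⱼ
    -- If Y⁽ʲ⁾ ≤ X⁽ⁱ⁾, then Y⁽ʲ⁾ is also at most the witness `v`, whose rank among the ys is then
    -- too large.
    from b with v , _ , i< , ≤i ← find b = ≰⇒> λ yⱼ≤xᵢ →
      ℕ.≤⇒≯ ≤i (≡.subst (ℕ._< rank v (tabulate y)) (≡.sym i≡j) (Y.to v (≤-trans yⱼ≤xᵢ (X.from v i<))))

  -- Unlike `countBelow`, this has a meaning for lists with fewer than `k` entries, which occur
  -- along a path: an index without an x does not count, and a missing y behaves like infinity.
  numberBelow : ℕ → List Carrier → List Carrier → ℕ
  numberBelow k xs ys = count (λ t → does (below? t xs ys)) k

  module _ {m n k} (k≤m : k ℕ.≤ m) (k≤n : k ℕ.≤ n) (x : Vector Carrier m) (y : Vector Carrier n) where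

    orderStatistic-inject≤-< : ∀ t → orderStatistic O x (inject≤ t k≤m) < orderStatistic O y (inject≤ t k≤n) ⇔
                                     Below (toℕ t) (tabulate x) (tabulate y)
    orderStatistic-inject≤-< t = ≡.subst
      (λ s → orderStatistic O x (inject≤ t k≤m) < orderStatistic O y (inject≤ t k≤n) ⇔ Below s (tabulate x) (tabulate y))
      (Fin.toℕ-inject≤ t k≤m)
      (orderStatistic-< x y (inject≤ t k≤m) (inject≤ t k≤n)
        (≡.trans (Fin.toℕ-inject≤ t k≤m) (≡.sym (Fin.toℕ-inject≤ t k≤n))))

    countBelow≡numberBelow : countBelow O k k≤m k≤n x y ≡ numberBelow k (tabulate x) (tabulate y)
    countBelow≡numberBelow =
      length-filter-tabulate _ (λ t → does (below? t (tabulate x) (tabulate y))) id λ t →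
        does-⇔ (orderStatistic-inject≤-< t)
               (orderStatistic O x (inject≤ t k≤m) <? orderStatistic O y (inject≤ t k≤n))
               (below? (toℕ t) (tabulate x) (tabulate y))

  Below-↭ : ∀ t {xs xs′ ys ys′} → xs ↭ xs′ → ys ↭ ys′ → Below t xs ys → Below t xs′ ys′
  Below-↭ t {xs} {xs′} {ys} {ys′} p q b with v , v∈ , t< , ≤t ← find b =
    lose (∈-resp-↭ p v∈) (≡.subst (t ℕ.<_) (rank-↭ v p) t< , ≡.subst (ℕ._≤ t) (rank-↭ v q) ≤t)

  numberBelow-↭ : ∀ k → Invariant (numberBelow k)
  numberBelow-↭ k {xs} {xs′} {ys} {ys′} p q = count-cong
    (λ t → does-⇔ (mk⇔ (Below-↭ t {ys = ys} p q) (Below-↭ t {ys = ys′} (↭-sym p) (↭-sym q)))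
                  (below? t xs ys) (below? t xs′ ys′)) k

  _>_ : Rel Carrier ℓ₂
  _>_ = flip _<_

  rank-max : ∀ {z xs} → All (z >_) xs → rank z xs ≡ length xs
  rank-max z>xs = ≡.cong length (filter-all (_≤? _) (All.map inj₁ z>xs))

  rank-head : ∀ {z xs} → All (z >_) xs → rank z (z ∷ xs) ≡ suc (length xs)
  rank-head {z} {xs} z>xs = ≡.trans (≡.cong length (filter-accept (_≤? z) {xs = xs} ≤-refl)) (≡.cong suc (rank-max z>xs))

  rank-cons : ∀ {z x} xs → z > x → rank x (z ∷ xs) ≡ rank x xs
  rank-cons xs z>x = ≡.cong length (filter-reject (_≤? _) (<⇒≱ z>x))

  rank≤length : ∀ v xs → rank v xs ℕ.≤ length xs
  rank≤length v = length-filter (_≤? v)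

  ¬Below : ∀ {t xs ys} → length xs ℕ.≤ t → ¬ Below t xs ys
  ¬Below {t} {xs} len≤t b with v , _ , t< , _ ← find b =
    ℕ.<⇒≱ t< (ℕ.≤-trans (rank≤length v xs) len≤t)

  -- The new largest value `z` becomes the x of index `length xs`. It exceeds all ys present, so it
  -- lies below the y of that index exactly if there is no such y yet.
  Below-max : ∀ {t z xs ys} → AllPairs _>_ (z ∷ xs) → All (z >_) ys →
              Below t (z ∷ xs) ys ⇔ (t ≡ length xs × length ys ℕ.≤ length xs ⊎ Below t xs ys)
  Below-max {t} {z} {xs} {ys} (z>xs ∷ xs↘) z>ys = mk⇔ to from
    where
    -- At an index where an older x exists, the witness `z` can be replaced by the largest older x:
    -- its rank is `length xs`, and its rank among the ys cannot exceed their number.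
    nonempty : ∀ {xs} → AllPairs _>_ xs → t ℕ.< length xs → length ys ℕ.≤ t → Below t xs ys
    nonempty {x ∷ xs} (x>xs ∷ xs↘) t< ≤t =
      here (≡.subst (t ℕ.<_) (≡.sym (rank-head x>xs)) t< , ℕ.≤-trans (rank≤length x ys) ≤t)
    to : Below t (z ∷ xs) ys → t ≡ length xs × length ys ℕ.≤ length xs ⊎ Below t xs ys
    to (here (t< , ≤t)) rewrite rank-head z>xs | rank-max z>ys with ℕ.m≤n⇒m<n∨m≡n (ℕ.s≤s⁻¹ t<)
    ... | inj₁ t<len = inj₂ (nonempty xs↘ t<len ≤t)
    ... | inj₂ refl  = inj₁ (refl , ≤t)
    to (there b) with v , v∈ , t< , ≤t ← find b =
      inj₂ (lose v∈ (≡.subst (t ℕ.<_) (rank-cons xs (All.lookup z>xs v∈)) t< , ≤t))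
    from : t ≡ length xs × length ys ℕ.≤ length xs ⊎ Below t xs ys → Below t (z ∷ xs) ys
    from (inj₁ (refl , ≤len)) =
      here (≡.subst (length xs ℕ.<_) (≡.sym (rank-head z>xs)) (ℕ.n<1+n _) ,
            ≡.subst (ℕ._≤ length xs) (≡.sym (rank-max z>ys)) ≤len)
    from (inj₂ b) with v , v∈ , t< , ≤t ← find b =
      there (lose v∈ (≡.subst (t ℕ.<_) (≡.sym (rank-cons xs (All.lookup z>xs v∈))) t< , ≤t))

  -- A value above every x does not enter the rank of any x among the ys.
  Below-consʳ : ∀ {t z xs} ys → All (z >_) xs → Below t xs (z ∷ ys) ⇔ Below t xs ys
  Below-consʳ {t} {z} {xs} ys z>xs = mk⇔ to from
    where
    to : Below t xs (z ∷ ys) → Below t xs ys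
    to b with v , v∈ , t< , ≤t ← find b =
      lose v∈ (t< , ≡.subst (ℕ._≤ t) (rank-cons ys (All.lookup z>xs v∈)) ≤t)
    from : Below t xs ys → Below t xs (z ∷ ys)
    from b with v , v∈ , t< , ≤t ← find b =
      lose v∈ (t< , ≡.subst (ℕ._≤ t) (≡.sym (rank-cons ys (All.lookup z>xs v∈))) ≤t)

  -- In a descending list the last step of the path receives the largest value, so that the
  -- induction removes the maximum. If the step is horizontal from (a , c), this maximum is the x of
  -- index `a` and meets `c` smaller ys; it counts iff c ≤ a, that is, iff the edge lies below y =
  -- x.
  numberBelow-deal : ∀ k {m n} (p : Path m n) {zs} → length zs ≡ m ℕ.+ n → AllPairs _>_ zs →
                     numberBelow k (dealX p zs) (dealY p zs) ≡ exceedance k p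
  numberBelow-deal k start {[]} eq [] = none k
    where
    none : ∀ k → count (λ _ → false) k ≡ 0
    none zero    = refl
    none (suc k) = none k
  numberBelow-deal k (up {a} {c} p) {[]}     eq [] = contradiction (≡.trans eq (ℕ.+-suc a c)) λ ()
  numberBelow-deal k (up {a} {c} p) {z ∷ zs} eq (z>zs ∷ zs↘) = ≡.trans
    (count-cong (λ t → does-⇔ (Below-consʳ (dealY p zs) (All-resp-⊆ (dealX-⊆ p zs) z>zs))
                              (below? t (dealX p zs) (z ∷ dealY p zs)) (below? t (dealX p zs) (dealY p zs))) k)
    (numberBelow-deal k p (pred-+-suc a c eq) zs↘)
  numberBelow-deal k (right {a} {c} p) {z ∷ zs} eq (z>zs ∷ zs↘) = ≡.trans
    (count-insert a (c ℕ.≤ᵇ a) k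
      (dec-false (below? a xs ys) (¬Below {ys = ys} (ℕ.≤-reflexive lenX)))
      λ t → does-⇔ (≡.subst₂ (λ a′ c′ → Below t (z ∷ xs) ys ⇔ (t ≡ a′ × c′ ℕ.≤ a′ ⊎ Below t xs ys)) lenX lenY
                           (Below-max (All-resp-⊆ (dealX-⊆ p zs) z>zs ∷ AllPairs-resp-⊆ (dealX-⊆ p zs) zs↘)
                                      (All-resp-⊆ (dealY-⊆ p zs) z>zs)))
                   (below? t (z ∷ xs) ys)
                   ((t ℕ.≟ a ×-dec c ℕ.≤? a) ⊎-dec below? t xs ys))
    (≡.cong (_ ℕ.+_) (numberBelow-deal k p len zs↘))
    where
    xs = dealX p zs
    ys = dealY p zs
    len = ℕ.suc-injective eq
    lenX = length-dealX p zs len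
    lenY = length-dealY p zs len

  descending : ∀ zs → AllPairs (λ x y → ¬ x ≈ y) zs → ∃[ zs′ ] zs′ ↭ zs × AllPairs _>_ zs′
  descending zs distinct = sort′ zs , sort′-↭ zs , AllPairs.zipWith strict
    ( Sorted⇒AllPairs (DecTotalOrder.totalOrder DO′) (sort′-↗ zs)
    , ↭ₛ.AllPairs-resp-↭ (≡.setoid Carrier) (λ x≉y y≈x → x≉y (Eq.sym y≈x)) ((λ { refl → id }) , (λ { refl → id }))
        (↭⇒↭ₛ (↭-sym (sort′-↭ zs))) distinct)
    where
    -- Sorting for the reversed order puts the largest value first.
    DO′ = Flip.decTotalOrder DO
    open Sort DO′ using () renaming (sort to sort′; sort-↭ to sort′-↭; sort-↗ to sort′-↗)
    strict : ∀ {x y} → y ≤ x × ¬ x ≈ y → x > y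
    strict (inj₁ y<x , _)   = y<x
    strict (inj₂ y≈x , x≉y) = contradiction (Eq.sym y≈x) x≉y

  -- Sorting `zs` may change the value belonging to an individual path; only the sum over all paths
  -- is invariant. The predicate is therefore turned into a sum of indicators before the list is
  -- sorted.
  deal-count : ∀ m n k l zs → length zs ≡ m ℕ.+ n → AllPairs (λ x y → ¬ x ≈ y) zs →
               length (filter (λ p → numberBelow k (dealX p zs) (dealY p zs) ℕ.≟ l) (paths m n)) ≡ #paths m n k l
  deal-count m n k l zs eq distinct with zs′ , zs′↭zs , zs′↘ ← descending zs distinct = begin
    length (filter _ (paths m n))
      ≡⟨ length-filter≡sum (λ p → numberBelow k (dealX p zs) (dealY p zs) ℕ.≟ l) (paths m n) ⟩
    pathSum m n F zs
      ≡⟨ pathSum-↭ m n (λ p q → ≡.cong (λ c → indicator (does (c ℕ.≟ l))) (numberBelow-↭ k p q)) eq (↭-sym zs′↭zs) ⟩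
    pathSum m n F zs′
      ≡⟨ ≡.cong sum (map-cong (λ p → ≡.cong (λ c → indicator (does (c ℕ.≟ l)))
           (numberBelow-deal k p (≡.trans (↭-length zs′↭zs) eq) zs′↘)) (paths m n)) ⟩
    sum (map (λ p → indicator (does (exceedance k p ℕ.≟ l))) (paths m n))
      ≡⟨ length-filter≡sum (λ p → exceedance k p ℕ.≟ l) (paths m n) ⟨
    #paths m n k l ∎
    where
    open ≡-Reasoning
    F : List Carrier → List Carrier → ℕ
    F xs ys = indicator (does (numberBelow k xs ys ℕ.≟ l))

-- Ordered fields and limits

module RealProperties (ℝ : CompleteOrderedField) where

  open CompleteOrderedField ℝ hiding (zero)
  open IsTotalOrder ≤-isTotalOrder public
    using (isPartialOrder; total; antisym)
    renaming (refl to ≤-refl; trans to ≤-trans; reflexive to ≤-reflexive)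

  private
    poset : Poset _ _ _
    poset = record { isPartialOrder = isPartialOrder }

  open AbelianGroupProperties +-abelianGroup
  open RingProperties ring using (-‿distribˡ-*)
  module ≤-Reasoning = PosetReasoning poset
  open ≤-Reasoning

  +-mono-≤ : ∀ {w x y z} → w ≤ x → y ≤ z → w + y ≤ x + z
  +-mono-≤ {w} {x} {y} {z} w≤x y≤z = begin
    w + y ≤⟨ +-monoʳ-≤ w y≤z ⟩
    w + z ≈⟨ +-comm w z ⟩
    z + w ≤⟨ +-monoʳ-≤ z w≤x ⟩
    z + x ≈⟨ +-comm z x ⟩
    x + z ∎

  +-cancelˡ-≤ : ∀ z {x y} → z + x ≤ z + y → x ≤ y
  +-cancelˡ-≤ z {x} {y} z+x≤z+y = begin
    x             ≈⟨ -z+z+ x ⟨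
    - z + (z + x) ≤⟨ +-monoʳ-≤ (- z) z+x≤z+y ⟩
    - z + (z + y) ≈⟨ -z+z+ y ⟩
    y             ∎
    where
    -z+z+ : ∀ w → - z + (z + w) ≈ w
    -z+z+ w = trans (sym (+-assoc (- z) z w)) (trans (+-congʳ (-‿inverseˡ z)) (+-identityˡ w))

  x≤x+y : ∀ x {y} → 0# ≤ y → x ≤ x + y
  x≤x+y x {y} 0≤y = begin
    x      ≈⟨ +-identityʳ x ⟨
    x + 0# ≤⟨ +-monoʳ-≤ x 0≤y ⟩
    x + y  ∎

  0≤x+y : ∀ {x y} → 0# ≤ x → 0# ≤ y → 0# ≤ x + y
  0≤x+y 0≤x 0≤y = ≤-trans 0≤x (x≤x+y _ 0≤y)

  x-y+y≈x : ∀ x y → x - y + y ≈ x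
  x-y+y≈x x y = trans (+-assoc x (- y) y) (trans (+-congˡ (-‿inverseˡ y)) (+-identityʳ x))

  0≤y-x : ∀ {x y} → x ≤ y → 0# ≤ y - x
  0≤y-x {x} {y} x≤y = +-cancelˡ-≤ x (begin
    x + 0#      ≈⟨ +-identityʳ x ⟩
    x           ≤⟨ x≤y ⟩
    y           ≈⟨ x-y+y≈x y x ⟨
    (y - x) + x ≈⟨ +-comm (y - x) x ⟩
    x + (y - x) ∎)

  *-monoʳ-≤ : ∀ {c} → 0# ≤ c → ∀ {x y} → x ≤ y → x * c ≤ y * c
  *-monoʳ-≤ {c} 0≤c {x} {y} x≤y = begin
    x * c               ≤⟨ x≤x+y (x * c) (*-nonNegative (0≤y-x x≤y) 0≤c) ⟩
    x * c + (y - x) * c ≈⟨ distribʳ c x (y - x) ⟨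
    (x + (y - x)) * c   ≈⟨ *-congʳ (trans (+-comm x (y - x)) (x-y+y≈x y x)) ⟩
    y * c               ∎

  -- If 1 ≤ 0, then -1 is nonnegative, and so is its square, which is 1.
  0≤1 : 0# ≤ 1#
  0≤1 = [ id , from-1≤0 ]′ (total 0# 1#)
    where
    from-1≤0 : 1# ≤ 0# → 0# ≤ 1#
    from-1≤0 1≤0 = begin
      0#                      ≤⟨ *-nonNegative 0≤-1 0≤-1 ⟩
      (0# - 1#) * (0# - 1#)   ≈⟨ *-cong (+-identityˡ (- 1#)) (+-identityˡ (- 1#)) ⟩
      - 1# * - 1#             ≈⟨ -‿distribˡ-* 1# (- 1#) ⟨
      - (1# * - 1#)           ≈⟨ -‿cong (*-identityˡ (- 1#)) ⟩
      - - 1#                  ≈⟨ ⁻¹-involutive 1# ⟩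
      1#                      ∎
      where
      0≤-1 : 0# ≤ 0# - 1#
      0≤-1 = 0≤y-x 1≤0

  0≤fromℕ : ∀ n → 0# ≤ fromℕ n
  0≤fromℕ zero    = ≤-refl
  0≤fromℕ (suc n) = 0≤x+y 0≤1 (0≤fromℕ n)

  fromℕ≉0 : ∀ {n} → 0 ℕ.< n → fromℕ n ≉ 0#
  fromℕ≉0 {suc n} _ eq = 0#≉1# (antisym 0≤1 (begin
    1#              ≤⟨ x≤x+y 1# (0≤fromℕ n) ⟩
    fromℕ (suc n)   ≈⟨ eq ⟩
    0#              ∎))

  <⇒≱ : ∀ {x y} → x < y → ¬ y ≤ x
  <⇒≱ (x≤y , x≉y) y≤x = x≉y (antisym x≤y y≤x)

  ≰⇒> : ∀ {x y} → ¬ x ≤ y → y < x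
  ≰⇒> {x} {y} x≰y = [ ⊥-elim ∘ x≰y , id ]′ (total x y) , λ y≈x → x≰y (≤-reflexive (sym y≈x))

  x/y*y≈x : ∀ x {y} → y ≉ 0# → x / y * y ≈ x
  x/y*y≈x x {y} y≉0 = begin-equality
    x * y ⁻¹ * y   ≈⟨ *-assoc x (y ⁻¹) y ⟩
    x * (y ⁻¹ * y) ≈⟨ *-congˡ (*-comm (y ⁻¹) y) ⟩
    x * (y * y ⁻¹) ≈⟨ *-congˡ (⁻¹-inverseʳ y≉0) ⟩
    x * 1#         ≈⟨ *-identityʳ x ⟩
    x              ∎

  half : Carrier → Carrier
  half x = x / fromℕ 2

  half+half : ∀ x → half x + half x ≈ x
  half+half x = begin-equality
    half x + half x
      ≈⟨ +-cong (*-identityʳ (half x)) (trans (*-congˡ (+-identityʳ 1#)) (*-identityʳ (half x))) ⟨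
    half x * 1# + half x * (1# + 0#) ≈⟨ distribˡ (half x) 1# (1# + 0#) ⟨
    half x * fromℕ 2            ≈⟨ x/y*y≈x x (fromℕ≉0 {2} z<s) ⟩
    x                           ∎

  0<half : ∀ {x} → 0# < x → 0# < half x
  0<half {x} 0<x = ≰⇒> λ h≤0 → <⇒≱ 0<x (begin
    x               ≈⟨ half+half x ⟨
    half x + half x ≤⟨ +-mono-≤ h≤0 h≤0 ⟩
    0# + 0#         ≈⟨ +-identityˡ 0# ⟩
    0#              ∎)

  module _ (em : ∀ {ℓ} → ExcludedMiddle ℓ) where

    ≤-up-to-ε : ∀ {x y} → (∀ {ε} → 0# < ε → x ≤ y + ε) → x ≤ y
    ≤-up-to-ε {x} {y} bound with em {P = x ≤ y}
    ... | yes x≤y = x≤y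
    ... | no  x≰y = ⊥-elim (<⇒≱ 0<h h≤0)
      where
      -- With this ε the bound reads y + h + h ≤ y + h.
      h = half (x - y)
      0<x-y : 0# < x - y
      0<x-y = 0≤y-x (proj₁ (≰⇒> x≰y)) , λ 0≈x-y → x≰y (≤-reflexive (sym (begin-equality
        y           ≈⟨ +-identityˡ y ⟨
        0# + y      ≈⟨ +-congʳ 0≈x-y ⟩
        x - y + y   ≈⟨ x-y+y≈x x y ⟩
        x           ∎)))
      0<h = 0<half 0<x-y
      h≤0 : h ≤ 0#
      h≤0 = +-cancelˡ-≤ h (+-cancelˡ-≤ y (begin
        y + (h + h)  ≈⟨ +-congˡ (half+half (x - y)) ⟩
        y + (x - y)  ≈⟨ +-comm y (x - y) ⟩
        x - y + y    ≈⟨ x-y+y≈x x y ⟩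
        x            ≤⟨ bound 0<h ⟩
        y + h        ≈⟨ +-congˡ (+-identityʳ h) ⟨
        y + (h + 0#) ∎))

    -- The three summands are the three error terms in `null-from-sections`. A quarter of a given
    -- bound is used for each of them.
    ≤0-from-3ε : ∀ {x} → (∀ {ε} → 0# < ε → x ≤ ε + ε + ε) → x ≤ 0#
    ≤0-from-3ε {x} bound = ≤-up-to-ε λ {ε} 0<ε →
      let h = half ε; q = half h; 0<q = 0<half (0<half 0<ε) in begin
        x                  ≤⟨ bound 0<q ⟩
        q + q + q          ≤⟨ x≤x+y (q + q + q) (proj₁ 0<q) ⟩
        q + q + q + q      ≈⟨ +-assoc (q + q) q q ⟩
        (q + q) + (q + q)  ≈⟨ +-cong (half+half h) (half+half h) ⟩
        h + h              ≈⟨ half+half ε ⟩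
        ε                  ≈⟨ +-identityˡ ε ⟨
        0# + ε             ∎

    ⟶-eventually : ∀ {f x} → f ⟶ x → ∀ {ε} → 0# < ε → ∃[ n ] x ≤ f n + ε
    ⟶-eventually {f} {x} f⟶x {ε} 0<ε with N , close ← f⟶x 0<ε = N , (begin
      x         ≈⟨ x-y+y≈x x ε ⟨
      x - ε + ε ≤⟨ +-mono-≤ (proj₁ (proj₁ (close N ℕ.≤-refl))) ≤-refl ⟩
      f N + ε   ∎)

    -- The bound is asked for only from some index on, because a finite union is treated as a
    -- sequence padded with empty sets, whose partial sums are constant only eventually.
    ⟶-≤ : ∀ {f x y} → f ⟶ x → ∀ K → (∀ n → K ℕ.≤ n → f n ≤ y) → x ≤ y
    ⟶-≤ {f} {x} {y} f⟶x K f≤y = ≤-up-to-ε λ {ε} 0<ε →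
      let N , close = f⟶x 0<ε in begin
        x                 ≈⟨ x-y+y≈x x ε ⟨
        x - ε + ε         ≤⟨ +-mono-≤ (proj₁ (proj₁ (close (N ⊔ K) (ℕ.m≤m⊔n N K)))) ≤-refl ⟩
        f (N ⊔ K) + ε     ≤⟨ +-mono-≤ (f≤y (N ⊔ K) (ℕ.m≤n⊔m N K)) ≤-refl ⟩
        y + ε             ∎

    ⟶-≥ : ∀ {f x y} → f ⟶ x → ∀ K → (∀ n → K ℕ.≤ n → y ≤ f n) → y ≤ x
    ⟶-≥ {f} {x} {y} f⟶x K y≤f = ≤-up-to-ε λ {ε} 0<ε →
      let N , close = f⟶x 0<ε in begin
        y           ≤⟨ y≤f (N ⊔ K) (ℕ.m≤n⊔m N K) ⟩
        f (N ⊔ K)   ≤⟨ proj₁ (proj₂ (close (N ⊔ K) (ℕ.m≤m⊔n N K))) ⟩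
        x + ε       ∎

-- Measurable sets

module MeasurableSets (em : ∀ {ℓ} → ExcludedMiddle ℓ) {u} {A : Set u} (𝓐 : σ-Algebra A) where

  open σ-Algebra 𝓐

  dne : ∀ {p} {P : Set p} → ¬ ¬ P → P
  dne = decidable-stable em

  private
    pair : Pred A u → Pred A u → ℕ → Pred A u
    pair P Q zero    = P
    pair P Q (suc _) = Q

  infixr 7 _∩ᵐ_
  infixr 6 _∪ᵐ_

  -- By `Pr-cong` the probability of a set does not depend on the proof of its measurability, so
  -- these proofs can remain opaque.
  abstract

    ∅-measurable : Measurable (λ _ → ⊥)
    ∅-measurable = resp ((λ ¬⊤ → ⊥-elim (¬⊤ tt)) , λ ()) (complement whole)

    -- Such a set is everything or nothing. It arises in the section of a rectangle `P ⟨×⟩ Q` at b,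
    -- which is `P` cut with the constant `Q b`.
    const-measurable : ∀ (S : Set u) → Measurable (λ _ → S)
    const-measurable S with em {P = S}
    ... | yes s = resp ((λ _ → s) , (λ _ → tt)) whole
    ... | no ¬s = resp ((λ ()) , (λ s → ⊥-elim (¬s s))) ∅-measurable

    _∪ᵐ_ : ∀ {P Q} → Measurable P → Measurable Q → Measurable (P ∪ Q)
    _∪ᵐ_ {P} {Q} mP mQ = resp (to , from) (union {pair P Q} λ { zero → mP ; (suc _) → mQ })
      where
      to : ⋃ ℕ (pair P Q) ⊆ P ∪ Q
      to (zero  , p) = inj₁ p
      to (suc _ , q) = inj₂ q
      from : P ∪ Q ⊆ ⋃ ℕ (pair P Q)
      from (inj₁ p) = 0 , p
      from (inj₂ q) = 1 , q

    _∩ᵐ_ : ∀ {P Q} → Measurable P → Measurable Q → Measurable (P ∩ Q)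
    mP ∩ᵐ mQ = resp
      ( (λ ¬pq → dne (¬pq ∘ inj₁) , dne (¬pq ∘ inj₂))
      , (λ (p , q) → [ (λ ¬p → ¬p p) , (λ ¬q → ¬q q) ]′))
      (complement (complement mP ∪ᵐ complement mQ))

    ⋂-Fin-measurable : ∀ {N} {P : Fin N → Pred A u} → (∀ i → Measurable (P i)) → Measurable (⋂ (Fin N) P)
    ⋂-Fin-measurable {zero}  mP = resp ((λ _ ()) , (λ _ → tt)) whole
    ⋂-Fin-measurable {suc N} mP = resp
      ((λ { (p , ps) zero → p ; (p , ps) (suc i) → ps i }) , (λ ps → ps zero , ps ∘ suc))
      (mP zero ∩ᵐ ⋂-Fin-measurable (mP ∘ suc))

    ⋃-Fin-measurable : ∀ {N} {P : Fin N → Pred A u} → (∀ i → Measurable (P i)) → Measurable (⋃ (Fin N) P)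
    ⋃-Fin-measurable {N} mP = resp
      ((λ ¬∀ → dne λ ¬∃ → ¬∀ λ i p → ¬∃ (i , p)) , (λ (i , p) all → all i p))
      (complement (⋂-Fin-measurable (complement ∘ mP)))

    -- `P` is the predicate that is filtered by, `Q` an equivalent one that is known to be
    -- measurable. `R` is arbitrary so that it can absorb the successor when the head of the list
    -- passes the filter.
    length-filter-measurable : ∀ {i p} {I : Set i} {P : I → A → Set p} (P? : ∀ x → Decidable (λ i → P i x))
                               {Q : I → Pred A u} → (∀ i x → P i x → Q i x) → (∀ i x → Q i x → P i x) →
                               (∀ i → Measurable (Q i)) → ∀ is (R : Pred ℕ u) →
                               Measurable (λ x → R (length (filter (P? x) is)))
    length-filter-measurable P? to from mQ []       R = const-measurable (R 0)
    length-filter-measurable P? {Q} to from mQ (i ∷ is) R = resp (join , split)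
      ((mQ i ∩ᵐ length-filter-measurable P? to from mQ is (R ∘ suc)) ∪ᵐ
       (complement (mQ i) ∩ᵐ length-filter-measurable P? to from mQ is R))
      where
      join : ∀ {x} → (Q i x × R (suc (length (filter (P? x) is)))) ⊎ (¬ Q i x × R (length (filter (P? x) is))) →
             R (length (filter (P? x) (i ∷ is)))
      join {x} r with P? x i | r
      ... | yes p | inj₁ (_ , r′)  = r′
      ... | yes p | inj₂ (¬q , _)  = ⊥-elim (¬q (to i x p))
      ... | no ¬p | inj₁ (q , _)   = ⊥-elim (¬p (from i x q))
      ... | no ¬p | inj₂ (_ , r′)  = r′
      split : ∀ {x} → R (length (filter (P? x) (i ∷ is))) →
              (Q i x × R (suc (length (filter (P? x) is)))) ⊎ (¬ Q i x × R (length (filter (P? x) is)))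
      split {x} r with P? x i
      ... | yes p = inj₁ (to i x p , r)
      ... | no ¬p = inj₂ ((λ q → ¬p (from i x q)) , r)

preimage-measurable : ∀ {u} {A B : Set u} (𝓐 : σ-Algebra A) {G} {f : A → B} →
                      (∀ {P} → G P → σ-Algebra.Measurable 𝓐 (P ∘ f)) →
                      ∀ {P} → Generated G P → σ-Algebra.Measurable 𝓐 (P ∘ f)
preimage-measurable 𝓐 mG (gen-basic g)        = mG g
preimage-measurable 𝓐 mG (gen-resp (to , from) mP) = resp (to , from) (preimage-measurable 𝓐 mG mP)
  where open σ-Algebra 𝓐
preimage-measurable 𝓐 mG gen-whole            = σ-Algebra.whole 𝓐
preimage-measurable 𝓐 mG (gen-complement mP)  = σ-Algebra.complement 𝓐 (preimage-measurable 𝓐 mG mP)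
preimage-measurable 𝓐 mG (gen-union mP)       = σ-Algebra.union 𝓐 λ n → preimage-measurable 𝓐 mG (mP n)

-- Elementary properties of probability

module ProbabilityProperties (em : ∀ {ℓ} → ExcludedMiddle ℓ) (ℝ : CompleteOrderedField) {u}
                             (𝒫 : ProbabilitySpace ℝ u) where

  open CompleteOrderedField ℝ hiding (zero; refl)
  open RealProperties ℝ
  open ProbabilitySpace 𝒫
  open MeasurableSets em σ-algebra
  open ≤-Reasoning
  private module + = CommutativeMonoidSum +-commutativeMonoid

  ℙ : ∀ {E} → Measurable E → Carrier
  ℙ {E} = Pr E

  private
    variable
      E F : Pred Outcome u

    two : Pred Outcome u → Pred Outcome u → ℕ → Pred Outcome u
    two E F zero          = E
    two E F (suc zero)    = F
    two E F (suc (suc _)) = λ _ → ⊥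

    two-measurable : Measurable E → Measurable F → ∀ n → Measurable (two E F n)
    two-measurable mE mF zero          = mE
    two-measurable mE mF (suc zero)    = mF
    two-measurable mE mF (suc (suc _)) = ∅-measurable

  -- For the constantly empty sequence the partial sums are at least p + p from index 2 on and
  -- converge to p.
  ℙ-∅ : ℙ ∅-measurable ≈ 0#
  ℙ-∅ = antisym (+-cancelˡ-≤ p (begin
    p + p  ≤⟨ ⟶-≥ em (Pr-σ-additive (λ _ _ → ⊥) (λ _ → ∅-measurable) (λ _ _ ())) 2 2p≤ ⟩
    Pr _ (union λ _ → ∅-measurable)  ≈⟨ Pr-cong ((λ ()) , (λ ())) _ _ ⟩
    p      ≈⟨ +-identityʳ p ⟨
    p + 0# ∎)) (Pr-nonNegative _)
    where
    p = ℙ ∅-measurable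
    0≤∑ : ∀ n → 0# ≤ ∑ {n} (λ _ → p)
    0≤∑ zero    = ≤-refl
    0≤∑ (suc n) = 0≤x+y (Pr-nonNegative _) (0≤∑ n)
    2p≤ : ∀ n → 2 ℕ.≤ n → p + p ≤ ∑ {n} (λ _ → p)
    2p≤ (suc zero)    (s≤s ())
    2p≤ (suc (suc n)) _ = begin
      p + p                         ≤⟨ x≤x+y (p + p) (0≤∑ n) ⟩
      p + p + ∑ {n} (λ _ → p)       ≈⟨ +-assoc p p _ ⟩
      p + (p + ∑ {n} (λ _ → p))     ∎

  ℙ-empty : (mE : Measurable E) → Empty E → ℙ mE ≈ 0#
  ℙ-empty mE ¬E = trans (Pr-cong ((λ e → ⊥-elim (¬E _ e)) , (λ ())) mE _) ℙ-∅

  -- Finite additivity is σ-additivity for the sequence `E`, `F` followed by empty sets; its partial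
  -- sums no longer change from index 2 on.
  ℙ-∪ : (mE : Measurable E) (mF : Measurable F) → Empty (E ∩ F) → (mE∪F : Measurable (E ∪ F)) →
        ℙ mE∪F ≈ ℙ mE + ℙ mF
  ℙ-∪ {E} {F} mE mF ¬E∩F mE∪F = trans
    (Pr-cong (to , from) _ _)
    (antisym (⟶-≤ em limit 2 λ n 2≤n → ≤-reflexive (sums n 2≤n))
             (⟶-≥ em limit 2 λ n 2≤n → ≤-reflexive (sym (sums n 2≤n))))
    where
    to : E ∪ F ⊆ ⋃ ℕ (two E F)
    to (inj₁ e) = 0 , e
    to (inj₂ f) = 1 , f
    from : ⋃ ℕ (two E F) ⊆ E ∪ F
    from (zero        , e) = inj₁ e
    from (suc zero    , f) = inj₂ f
    disjoint : ∀ {i j} → i ≢ j → Empty (two E F i ∩ two E F j)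
    disjoint {zero}        {zero}        i≢j = ⊥-elim (i≢j refl)
    disjoint {zero}        {suc zero}    i≢j = ¬E∩F
    disjoint {zero}        {suc (suc _)} i≢j _ (_ , ())
    disjoint {suc zero}    {zero}        i≢j x (f , e) = ¬E∩F x (e , f)
    disjoint {suc zero}    {suc zero}    i≢j = ⊥-elim (i≢j refl)
    disjoint {suc zero}    {suc (suc _)} i≢j _ (_ , ())
    disjoint {suc (suc _)}               i≢j _ (() , _)
    limit = Pr-σ-additive (two E F) (two-measurable mE mF) disjoint
    sums : ∀ n → 2 ℕ.≤ n → ∑ {n} (λ i → Pr _ (two-measurable mE mF (toℕ i))) ≈ ℙ mE + ℙ mF
    sums (suc zero)    (s≤s ())
    sums (suc (suc n)) _ = +-congˡ (trans (+-congˡ (trans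
      (+.sum-cong-≋ {n} (λ _ → ℙ-∅)) (+.sum-replicate-zero n))) (+-identityʳ _))

  ℙ-split : (mE : Measurable E) (mF : Measurable F) →
            ℙ mE ≈ ℙ (mE ∩ᵐ mF) + ℙ (mE ∩ᵐ complement mF)
  ℙ-split {E} {F} mE mF = trans
    (Pr-cong (to , [ proj₁ , proj₁ ]′) mE (mE ∩ᵐ mF ∪ᵐ mE ∩ᵐ complement mF))
    (ℙ-∪ (mE ∩ᵐ mF) (mE ∩ᵐ complement mF) (λ _ ((_ , f) , (_ , ¬f)) → ¬f f) _)
    where
    to : E ⊆ (E ∩ F) ∪ (E ∩ ∁ F)
    to {x} e with em {P = F x}
    ... | yes f = inj₁ (e , f)
    ... | no ¬f = inj₂ (e , ¬f)

  ℙ-mono : (mE : Measurable E) (mF : Measurable F) → E ⊆ F → ℙ mE ≤ ℙ mF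
  ℙ-mono mE mF E⊆F = begin
    ℙ mE                                      ≈⟨ Pr-cong ((λ e → E⊆F e , e) , proj₂) mE (mF ∩ᵐ mE) ⟩
    ℙ (mF ∩ᵐ mE)                              ≤⟨ x≤x+y _ (Pr-nonNegative _) ⟩
    ℙ (mF ∩ᵐ mE) + ℙ (mF ∩ᵐ complement mE)    ≈⟨ ℙ-split mF mE ⟨
    ℙ mF                                      ∎

  ℙ-subadditive : (mE : Measurable E) (mF : Measurable F) (mE∪F : Measurable (E ∪ F)) → ℙ mE∪F ≤ ℙ mE + ℙ mF
  ℙ-subadditive mE mF mE∪F = begin
    ℙ mE∪F                                          ≈⟨ ℙ-split mE∪F mE ⟩
    ℙ (mE∪F ∩ᵐ mE) + ℙ (mE∪F ∩ᵐ complement mE)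
      ≤⟨ +-mono-≤ (ℙ-mono _ _ proj₂) (ℙ-mono _ _ λ { (inj₁ e , ¬e) → ⊥-elim (¬e e) ; (inj₂ f , _) → f }) ⟩
    ℙ mE + ℙ mF                                     ∎

  ℙ-complement : (mE : Measurable E) → ℙ mE + ℙ (complement mE) ≈ 1#
  ℙ-complement {E} mE = trans (sym (ℙ-∪ mE (complement mE) (λ _ (e , ¬e) → ¬e e) (mE ∪ᵐ complement mE)))
    (trans (Pr-cong ((λ _ → tt) , (λ {x} _ → total-E x)) _ whole) Pr-whole)
    where
    total-E : ∀ x → (E ∪ ∁ E) x
    total-E x with em {P = E x}
    ... | yes e = inj₁ e
    ... | no ¬e = inj₂ ¬e

  ℙ≤1 : (mE : Measurable E) → ℙ mE ≤ 1#
  ℙ≤1 mE = ≤-trans (ℙ-mono mE whole λ _ → tt) (≤-reflexive Pr-whole)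

  ℙ-disjoint-sum : ∀ n {D : ℕ → Pred Outcome u} (mD : ∀ i → Measurable (D i)) →
                   (∀ {i j} → i ≢ j → Empty (D i ∩ D j)) → (mE : Measurable E) →
                   (∀ i → i ℕ.< n → D i ⊆ E) → ∑ {n} (λ i → ℙ (mD (toℕ i))) ≤ ℙ mE
  ℙ-disjoint-sum zero    mD disjoint mE D⊆E = Pr-nonNegative mE
  ℙ-disjoint-sum (suc n) {D} mD disjoint mE D⊆E = begin
    ℙ (mD 0) + ∑ {n} (λ i → ℙ (mD (suc (toℕ i))))
      ≤⟨ +-mono-≤ (ℙ-mono _ _ λ d → D⊆E 0 z<s d , d)
                  (ℙ-disjoint-sum n (mD ∘ suc) (λ i≢j → disjoint (i≢j ∘ ℕ.suc-injective)) (mE ∩ᵐ complement (mD 0))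
                    λ i i<n d → D⊆E (suc i) (s<s i<n) d , λ d₀ → disjoint {suc i} {0} (λ ()) _ (d , d₀)) ⟩
    ℙ (mE ∩ᵐ mD 0) + ℙ (mE ∩ᵐ complement (mD 0))
      ≈⟨ ℙ-split mE (mD 0) ⟨
    ℙ mE ∎

  module _ {E : ℕ → Pred Outcome u} (mE : ∀ n → Measurable (E n)) (E↗ : ∀ n → E n ⊆ E (suc n)) where

    private
      E-mono : ∀ {i j} → i ℕ.≤′ j → E i ⊆ E j
      E-mono ℕ.≤′-refl       e = e
      E-mono (ℕ.≤′-step i≤j) e = E↗ _ (E-mono i≤j e)

      D : ℕ → Pred Outcome u
      D zero    = E 0
      D (suc n) = E (suc n) ∩ ∁ (E n)

      D⊆E : ∀ n → D n ⊆ E n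
      D⊆E zero    d = d
      D⊆E (suc n) d = proj₁ d

      mD : ∀ n → Measurable (D n)
      mD zero    = mE 0
      mD (suc n) = mE (suc n) ∩ᵐ complement (mE n)

      disjoint< : ∀ {i j} → i ℕ.< j → Empty (D i ∩ D j)
      disjoint< {i} {suc j} (s≤s i≤j) x (dᵢ , (_ , ¬eⱼ)) = ¬eⱼ (E-mono (ℕ.≤⇒≤′ i≤j) (D⊆E i dᵢ))

      disjoint : ∀ {i j} → i ≢ j → Empty (D i ∩ D j)
      disjoint {i} {j} i≢j x (dᵢ , dⱼ) with ℕ.<-cmp i j
      ... | tri< i<j _ _ = disjoint< i<j x (dᵢ , dⱼ)
      ... | tri≈ _ i≡j _ = i≢j i≡j
      ... | tri> _ _ j<i = disjoint< j<i x (dⱼ , dᵢ)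

      -- A point of `E n` belongs to the increment at the least index whose set contains it.
      first : ∀ n {x} → E n x → ⋃ ℕ D x
      first zero    e = 0 , e
      first (suc n) {x} e with em {P = E n x}
      ... | yes e′ = first n e′
      ... | no ¬e′ = suc n , e , ¬e′

    -- σ-additivity is applied to the disjoint increments `D` of the sequence.
    ℙ-continuous-from-below : ∀ {F} (mF : Measurable F) → F ⊆ ⋃ ℕ E → ∀ {ε} → 0# < ε → ∃[ n ] ℙ mF ≤ ℙ (mE n) + ε
    ℙ-continuous-from-below mF F⊆ {ε} 0<ε with n , close ← ⟶-eventually em (Pr-σ-additive D mD disjoint) 0<ε = n , (begin
      ℙ mF                                ≤⟨ ℙ-mono mF (union mD) (λ f → let k , e = F⊆ f in first k e) ⟩
      ℙ (union mD)                        ≤⟨ close ⟩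
      ∑ {n} (λ i → ℙ (mD (toℕ i))) + ε
        -- The partial sum stops before index `n`; bounding it by `E n` also covers the empty sum at
        -- n = 0.
        ≤⟨ +-mono-≤ (ℙ-disjoint-sum n mD disjoint (mE n) λ i i<n d → E-mono (ℕ.≤⇒≤′ (ℕ.<⇒≤ i<n)) (D⊆E i d)) ≤-refl ⟩
      ℙ (mE n) + ε                        ∎)

  ℙ-continuous-from-above : ∀ {E : ℕ → Pred Outcome u} (mE : ∀ n → Measurable (E n)) → (∀ n → E (suc n) ⊆ E n) →
                            (mF : Measurable F) → ⋂ ℕ E ⊆ F → ∀ {ε} → 0# < ε → ∃[ n ] ℙ (mE n) ≤ ℙ mF + ε
  ℙ-continuous-from-above {F} {E} mE E↘ mF ⋂E⊆F {ε} 0<ε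
    with n , close ← ℙ-continuous-from-below (complement ∘ mE) (λ n ¬e e → ¬e (E↘ n e)) (complement mF)
                       (λ ¬f → dne λ ¬∃ → ¬f (⋂E⊆F λ n → dne λ ¬e → ¬∃ (n , ¬e))) 0<ε
    = n , +-cancelˡ-≤ (ℙ (complement (mE n))) (begin
      ℙ (complement (mE n)) + ℙ (mE n)         ≈⟨ trans (+-comm _ _) (ℙ-complement (mE n)) ⟩
      1#                                       ≈⟨ ℙ-complement mF ⟨
      ℙ mF + ℙ (complement mF)                 ≤⟨ +-monoʳ-≤ (ℙ mF) close ⟩
      ℙ mF + (ℙ (complement (mE n)) + ε)       ≈⟨ x∙yz≈y∙xz (ℙ mF) _ ε ⟩
      ℙ (complement (mE n)) + (ℙ mF + ε)       ∎)
    where open CommutativeSemigroupProperties +-commutativeSemigroup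

  AlmostSure : Pred Outcome u → Set (lsuc u)
  AlmostSure E = Σ[ mE ∈ Measurable E ] ℙ mE ≈ 1#

  ℙ-∩-almostSure : ∀ {E F} (mE : Measurable E) ((mF , _) : AlmostSure F) → ℙ (mE ∩ᵐ mF) ≈ ℙ mE
  ℙ-∩-almostSure mE (mF , ℙF≈1) = sym (begin-equality
    ℙ mE                                      ≈⟨ ℙ-split mE mF ⟩
    ℙ (mE ∩ᵐ mF) + ℙ (mE ∩ᵐ complement mF)
      ≈⟨ +-congˡ (antisym (≤-trans (ℙ-mono _ (complement mF) proj₂) ∁F≤0) (Pr-nonNegative _)) ⟩
    ℙ (mE ∩ᵐ mF) + 0#                         ≈⟨ +-identityʳ _ ⟩
    ℙ (mE ∩ᵐ mF)                              ∎)
    where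
    ∁F≤0 : ℙ (complement mF) ≤ 0#
    ∁F≤0 = +-cancelˡ-≤ 1# (≤-reflexive (trans (+-congʳ (sym ℙF≈1)) (trans (ℙ-complement mF) (sym (+-identityʳ 1#)))))

  almostSure-⋂ : ∀ {K} {E : Fin K → Pred Outcome u} → (∀ i → AlmostSure (E i)) → AlmostSure (⋂ (Fin K) E)
  almostSure-⋂ sure = ⋂-Fin-measurable (proj₁ ∘ sure) , ℙ-⋂ sure
    where
    ℙ-⋂ : ∀ {K} {E : Fin K → Pred Outcome u} (sure : ∀ i → AlmostSure (E i)) → ℙ (⋂-Fin-measurable (proj₁ ∘ sure)) ≈ 1#
    ℙ-⋂ {zero}  sure = trans (Pr-cong ((λ _ → tt) , λ _ ()) _ whole) Pr-whole
    ℙ-⋂ {suc K} sure = begin-equality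
      ℙ (⋂-Fin-measurable (proj₁ ∘ sure))
        ≈⟨ Pr-cong ((λ e → e zero , e ∘ suc) , (λ { (e , es) zero → e ; (e , es) (suc i) → es i })) _ _ ⟩
      ℙ (proj₁ (sure zero) ∩ᵐ ⋂-Fin-measurable (proj₁ ∘ sure ∘ suc))
        ≈⟨ ℙ-∩-almostSure (proj₁ (sure zero)) (_ , ℙ-⋂ (sure ∘ suc)) ⟩
      ℙ (proj₁ (sure zero))
        ≈⟨ proj₂ (sure zero) ⟩
      1# ∎

-- Boolean formulas and their countable unions

private
  -- Each antidiagonal is traversed from (s , 0) to (0 , s), after which the walk jumps to (s + 1 ,
  -- 0).
  next : ℕ × ℕ → ℕ × ℕ
  next (zero  , j) = suc j , zero
  next (suc i , j) = i , suc j

unpair : ℕ → ℕ × ℕ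
unpair zero    = 0 , 0
unpair (suc k) = next (unpair k)

unpair-surjective : ∀ i j → ∃[ k ] unpair k ≡ (i , j)
unpair-surjective i j = along i j (axis (j ℕ.+ i))
  where
  along : ∀ i j → ∃[ k ] unpair k ≡ (j ℕ.+ i , 0) → ∃[ k ] unpair k ≡ (i , j)
  along i zero    p = p
  along i (suc j) p with k , eq ← along (suc i) j (≡.subst (λ s → ∃[ k ] unpair k ≡ (s , 0)) (≡.sym (ℕ.+-suc j i)) p)
    = suc k , ≡.cong next eq
  axis : ∀ s → ∃[ k ] unpair k ≡ (s , 0)
  axis zero    = 0 , refl
  axis (suc s) with k , eq ← along 0 s (≡.subst (λ s → ∃[ k ] unpair k ≡ (s , 0)) (≡.sym (ℕ.+-identityʳ s)) (axis s))
    = suc k , ≡.cong next eq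

module _ {u} {A : Set u} (G : Pred (Pred A u) (lsuc u)) where

  infixr 7 _and_

  -- The Boolean algebra generated by `G`, kept as syntax so that a proof can recurse over the
  -- finitely many generators that occur in an element.
  data Formula : Set (lsuc u) where
    everything : Formula
    atom       : ∀ {P} → G P → Formula
    not        : Formula → Formula
    _and_      : Formula → Formula → Formula

  infixr 6 _or_

  _or_ : Formula → Formula → Formula
  φ or ψ = not (not φ and not ψ)

  prefix : (ℕ → Formula) → ℕ → Formula
  prefix φ zero    = φ 0
  prefix φ (suc n) = prefix φ n or φ (suc n)

  -- The intersection of two countable unions, distributed over all pairs of members.
  meet : (ℕ → Formula) → (ℕ → Formula) → ℕ → Formula
  meet φ ψ k = φ (proj₁ (unpair k)) and ψ (proj₂ (unpair k))

module _ {u} {A : Set u} {G : Pred (Pred A u) (lsuc u)} where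

  ⟦_⟧ : Formula G → Pred A u
  ⟦ everything ⟧   = λ _ → ⊤
  ⟦ atom {P} _ ⟧   = P
  ⟦ not φ ⟧        = ∁ ⟦ φ ⟧
  ⟦ φ and ψ ⟧      = ⟦ φ ⟧ ∩ ⟦ ψ ⟧

  Open : (ℕ → Formula G) → Pred A u
  Open φ = ⋃ ℕ (⟦_⟧ ∘ φ)

  -- Each cell comes with a relation that relates points of the cell; cutting a cell
  -- along atoms makes a formula invariant under this relation.

  refine : ∀ {c q} {Cell : Set c} (R : Cell → Rel A u) → (∀ c → Symmetric (R c)) → (Q : Cell → Set q) →
           (∀ {P} → G P → ∀ c → (∀ c′ → R c′ ⇒ R c → P Respects R c′ → Q c′) → Q c) →
           ∀ φ c → (∀ c′ → R c′ ⇒ R c → ⟦ φ ⟧ Respects R c′ → Q c′) → Q c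
  refine R R-sym Q cut everything c q = q c id λ _ _ → tt
  refine R R-sym Q cut (atom g)   c q = cut g c q
  refine R R-sym Q cut (not φ)    c q = refine R R-sym Q cut φ c λ c′ c′⊑c φ-resp →
    q c′ c′⊑c λ r ¬x y → ¬x (φ-resp (R-sym c′ r) y)
  refine R R-sym Q cut (φ and ψ)  c q = refine R R-sym Q cut φ c λ c′ c′⊑c φ-resp →
    refine R R-sym Q cut ψ c′ λ c″ c″⊑c′ ψ-resp →
    q c″ (c′⊑c ∘ c″⊑c′) λ r (x , y) → φ-resp (c″⊑c′ r) x , ψ-resp r y

  open-meet⁻ : ∀ φ ψ → Open (meet G φ ψ) ⊆ Open φ ∩ Open ψ
  open-meet⁻ φ ψ (k , x , y) = (_ , x) , (_ , y)

  open-meet⁺ : ∀ φ ψ → Open φ ∩ Open ψ ⊆ Open (meet G φ ψ)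
  open-meet⁺ φ ψ {x} ((i , φᵢ) , (j , ψⱼ)) with k , eq ← unpair-surjective i j =
    k , ≡.subst (λ p → ⟦ φ (proj₁ p) and ψ (proj₂ p) ⟧ x) (≡.sym eq) (φᵢ , ψⱼ)

  module _ (em : ∀ {ℓ} → ExcludedMiddle ℓ) where

    or⁺ : ∀ φ ψ → ⟦ φ ⟧ ∪ ⟦ ψ ⟧ ⊆ ⟦ _or_ G φ ψ ⟧
    or⁺ φ ψ (inj₁ x) (¬x , _) = ¬x x
    or⁺ φ ψ (inj₂ y) (_ , ¬y) = ¬y y

    or⁻ : ∀ φ ψ → ⟦ _or_ G φ ψ ⟧ ⊆ ⟦ φ ⟧ ∪ ⟦ ψ ⟧
    or⁻ φ ψ z = decidable-stable em λ ¬∪ → z (¬∪ ∘ inj₁ , ¬∪ ∘ inj₂)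

    prefix-suc : ∀ φ n → ⟦ prefix G φ n ⟧ ⊆ ⟦ prefix G φ (suc n) ⟧
    prefix-suc φ n x = or⁺ (prefix G φ n) (φ (suc n)) (inj₁ x)

    prefix⁻ : ∀ φ n → ⟦ prefix G φ n ⟧ ⊆ Open φ
    prefix⁻ φ zero    x = 0 , x
    prefix⁻ φ (suc n) x = [ prefix⁻ φ n , suc n ,_ ]′ (or⁻ (prefix G φ n) (φ (suc n)) x)

    prefix⁺ : ∀ φ → Open φ ⊆ ⋃ ℕ (⟦_⟧ ∘ prefix G φ)
    prefix⁺ φ (zero  , x) = 0 , x
    prefix⁺ φ (suc n , x) = suc n , or⁺ (prefix G φ n) (φ (suc n)) (inj₂ x)

    formula-generated : ∀ φ → Generated G ⟦ φ ⟧
    formula-generated everything = gen-whole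
    formula-generated (atom g)   = gen-basic g
    formula-generated (not φ)    = gen-complement (formula-generated φ)
    formula-generated (φ and ψ)  = formula-generated φ ∩ᵐ formula-generated ψ
      where open MeasurableSets em (generatedBy G)

-- Approximation of generated sets by formulas

-- Both a measurable set and its complement can be covered by countable unions of
-- formulas in such a way that the covers overlap in a set of small probability;
-- asking for both covers at once makes the property pass to complements.

module Approximation (em : ∀ {ℓ} → ExcludedMiddle ℓ) (ℝ : CompleteOrderedField) {u} (𝒫 : ProbabilitySpace ℝ u)
                     {A : Set u} {G : Pred (Pred A u) (lsuc u)} (f : ProbabilitySpace.Outcome 𝒫 → A)
                     (mG : ∀ {P} → G P → ProbabilitySpace.Measurable 𝒫 (P ∘ f)) where

  open CompleteOrderedField ℝ hiding (zero; refl)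
  open RealProperties ℝ
  open ProbabilitySpace 𝒫
  open MeasurableSets em σ-algebra
  open ProbabilityProperties em ℝ 𝒫
  open ≤-Reasoning

  m* : ∀ {S} → Generated G S → Measurable (S ∘ f)
  m* = preimage-measurable σ-algebra mG

  m⟦_⟧ : ∀ φ → Measurable (⟦ φ ⟧ ∘ f)
  m⟦ φ ⟧ = m* (formula-generated em φ)

  m-open : ∀ φ → Measurable (Open φ ∘ f)
  m-open φ = union λ n → m⟦ φ n ⟧

  Approximable : Pred A u → Carrier → Set (lsuc u)
  Approximable S ε = ∃[ φ ] ∃[ ψ ] S ⊆ Open φ × ∁ S ⊆ Open ψ × ℙ (m-open φ ∩ᵐ m-open ψ) ≤ ε

  module CountableUnion {P : ℕ → Pred A u} {ε : Carrier} (0<ε : 0# < ε)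
                        (approximable : ∀ n {δ} → 0# < δ → Approximable (P n) δ) where

    -- What is left of the budget `half ε` before `P n` is treated. Half of the remainder is then
    -- spent on `P n`, and `overlaps≤` records that spending and remainder together stay within the
    -- budget.
    weight : ℕ → Carrier
    weight zero    = half ε
    weight (suc n) = half (weight n)

    0<weight : ∀ n → 0# < weight n
    0<weight zero    = 0<half 0<ε
    0<weight (suc n) = 0<half (0<weight n)

    φ ψ : ℕ → ℕ → Formula G
    φ n = proj₁ (approximable n (0<weight (suc n)))
    ψ n = proj₁ (proj₂ (approximable n (0<weight (suc n))))

    P⊆φ : ∀ n → P n ⊆ Open (φ n)
    P⊆φ n = proj₁ (proj₂ (proj₂ (approximable n (0<weight (suc n)))))

    ∁P⊆ψ : ∀ n → ∁ (P n) ⊆ Open (ψ n)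
    ∁P⊆ψ n = proj₁ (proj₂ (proj₂ (proj₂ (approximable n (0<weight (suc n))))))

    m-overlap : ∀ n → Measurable ((Open (φ n) ∘ f) ∩ (Open (ψ n) ∘ f))
    m-overlap n = m-open (φ n) ∩ᵐ m-open (ψ n)

    overlap≤ : ∀ n → ℙ (m-overlap n) ≤ weight (suc n)
    overlap≤ n = proj₂ (proj₂ (proj₂ (proj₂ (approximable n (0<weight (suc n))))))

    overlaps : ℕ → Pred Outcome u
    overlaps zero    = λ _ → ⊥
    overlaps (suc n) = overlaps n ∪ ((Open (φ n) ∘ f) ∩ (Open (ψ n) ∘ f))

    m-overlaps : ∀ n → Measurable (overlaps n)
    m-overlaps zero    = ∅-measurable
    m-overlaps (suc n) = m-overlaps n ∪ᵐ m-overlap n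

    overlaps≤ : ∀ n → ℙ (m-overlaps n) + weight n ≤ half ε
    overlaps≤ zero    = ≤-reflexive (trans (+-congʳ ℙ-∅) (+-identityˡ _))
    overlaps≤ (suc n) = begin
      ℙ (m-overlaps (suc n)) + w′
        ≤⟨ +-mono-≤ (ℙ-subadditive (m-overlaps n) (m-overlap n) _) ≤-refl ⟩
      ℙ (m-overlaps n) + ℙ (m-overlap n) + w′
        ≤⟨ +-mono-≤ (+-monoʳ-≤ _ (overlap≤ n)) ≤-refl ⟩
      ℙ (m-overlaps n) + w′ + w′
        ≈⟨ trans (+-assoc _ w′ w′) (+-congˡ (half+half (weight n))) ⟩
      ℙ (m-overlaps n) + weight n
        ≤⟨ overlaps≤ n ⟩
      half ε ∎
      where w′ = weight (suc n)

    ⋃overlaps≤ : ℙ (union m-overlaps) ≤ half ε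
    ⋃overlaps≤ = ≤-up-to-ε em λ {δ} 0<δ →
      let n , close = ℙ-continuous-from-below m-overlaps (λ n → inj₁) (union m-overlaps) id 0<δ in begin
        ℙ (union m-overlaps)             ≤⟨ close ⟩
        ℙ (m-overlaps n) + δ
          ≤⟨ +-mono-≤ (≤-trans (x≤x+y _ (proj₁ (0<weight n))) (overlaps≤ n)) ≤-refl ⟩
        half ε + δ                       ∎

    Φ : ℕ → Formula G
    Φ k = φ (proj₁ (unpair k)) (proj₂ (unpair k))

    P⊆Φ : ⋃ ℕ P ⊆ Open Φ
    P⊆Φ {x} (n , p) = let i , φₙᵢ = P⊆φ n p; k , eq = unpair-surjective n i in
      k , ≡.subst (λ q → ⟦ φ (proj₁ q) (proj₂ q) ⟧ x) (≡.sym eq) φₙᵢ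

    -- The complement of the union is covered by the intersection of all `Open (ψ n)`, but an
    -- infinite intersection of such covers need not be a countable union of formulas. Finitely many
    -- are intersected instead, and the second half of ε pays for stopping early.
    Ψ : ℕ → ℕ → Formula G
    Ψ zero    = λ _ → everything
    Ψ (suc n) = meet G (Ψ n) (ψ n)

    ∁P⊆Ψ : ∀ n → ∁ (⋃ ℕ P) ⊆ Open (Ψ n)
    ∁P⊆Ψ zero    ¬p = 0 , tt
    ∁P⊆Ψ (suc n) ¬p = open-meet⁺ (Ψ n) (ψ n) (∁P⊆Ψ n ¬p , ∁P⊆ψ n (λ p → ¬p (n , p)))

    excess : ℕ → Pred Outcome u
    excess n = (Open Φ ∘ f) ∩ (Open (Ψ n) ∘ f)

    m-excess : ∀ n → Measurable (excess n)
    m-excess n = m-open Φ ∩ᵐ m-open (Ψ n)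

    ⋂excess⊆ : ⋂ ℕ excess ⊆ ⋃ ℕ overlaps
    -- The member of `Φ` that contains the point comes from the cover of some `P n`. Index `suc n`
    -- is the first at which `Ψ` includes the cover `ψ n` of the complement of that `P n`.
    ⋂excess⊆ all = let k , x = proj₁ (all 0); n = proj₁ (unpair k) in
      suc n , inj₂ ((_ , x) , proj₂ (open-meet⁻ (Ψ n) (ψ n) (proj₂ (all (suc n)))))

    excess-eventually : ∃[ n ] ℙ (m-excess n) ≤ ℙ (union m-overlaps) + half ε
    excess-eventually = ℙ-continuous-from-above m-excess
      (λ n (x , y) → x , proj₁ (open-meet⁻ (Ψ n) (ψ n) y)) (union m-overlaps) ⋂excess⊆ (0<half 0<ε)

    approximation : Approximable (⋃ ℕ P) ε
    approximation = Φ , Ψ n , P⊆Φ , ∁P⊆Ψ n , (begin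
      ℙ (m-excess n)                   ≤⟨ proj₂ excess-eventually ⟩
      ℙ (union m-overlaps) + half ε    ≤⟨ +-mono-≤ ⋃overlaps≤ ≤-refl ⟩
      half ε + half ε                  ≈⟨ half+half ε ⟩
      ε                                ∎)
      where n = proj₁ excess-eventually

  private
    approximate-formula : ∀ φ {ε} → 0# < ε → Approximable ⟦ φ ⟧ ε
    approximate-formula φ {ε} 0<ε = φs , ψs , (0 ,_) , (0 ,_) , (begin
      ℙ (m-open φs ∩ᵐ m-open ψs)
        ≈⟨ ℙ-empty (m-open φs ∩ᵐ m-open ψs) (λ _ ((_ , x) , (_ , ¬x)) → ¬x x) ⟩
      0#  ≤⟨ proj₁ 0<ε ⟩
      ε   ∎)
      where
      φs ψs : ℕ → Formula G
      φs _ = φ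
      ψs _ = not φ

    approximate-resp : ∀ {S T ε} → S ≐ T → Approximable S ε → Approximable T ε
    approximate-resp (to , from) (φ , ψ , S⊆ , ∁S⊆ , ≤ε) =
      φ , ψ , (λ t → S⊆ (from t)) , (λ ¬t → ∁S⊆ (λ s → ¬t (to s))) , ≤ε

    approximate-complement : ∀ {S ε} → Approximable S ε → Approximable (∁ S) ε
    approximate-complement {S} (φ , ψ , S⊆ , ∁S⊆ , ≤ε) =
      ψ , φ , ∁S⊆ , (λ ¬¬x → S⊆ (dne ¬¬x)) ,
      ≤-trans (ℙ-mono (m-open ψ ∩ᵐ m-open φ) (m-open φ ∩ᵐ m-open ψ) λ (x , y) → y , x) ≤ε

  approximate : ∀ {S} → Generated G S → ∀ {ε} → 0# < ε → Approximable S ε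
  approximate (gen-basic g)       0<ε = approximate-formula (atom g) 0<ε
  approximate (gen-resp S≐T mS)   0<ε = approximate-resp S≐T (approximate mS 0<ε)
  approximate gen-whole           0<ε = approximate-formula everything 0<ε
  approximate (gen-complement mS) 0<ε = approximate-complement (approximate mS 0<ε)
  approximate (gen-union mP)      0<ε = CountableUnion.approximation 0<ε λ n → approximate (mP n)

-- Laws that agree on formulas

module _ (em : ∀ {ℓ} → ExcludedMiddle ℓ) (ℝ : CompleteOrderedField) {u} (𝒫 : ProbabilitySpace ℝ u)
         {A : Set u} {G : Pred (Pred A u) (lsuc u)} where

  open CompleteOrderedField ℝ hiding (zero; refl)
  open RealProperties ℝ
  open ProbabilitySpace 𝒫
  open ≤-Reasoning
  open MeasurableSets em σ-algebra
  open ProbabilityProperties em ℝ 𝒫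

  private
    module _ (f g : Outcome → A) (mf : ∀ {P} → G P → Measurable (P ∘ f)) (mg : ∀ {P} → G P → Measurable (P ∘ g)) where

      module f = Approximation em ℝ 𝒫 {G = G} f mf
      module g = Approximation em ℝ 𝒫 {G = G} g mg

      -- The cover of `S` is chosen to be tight under `g`, while under `f` it is only used as a
      -- cover. One of its finite parts nearly contains `S` under `f`, has the same probability
      -- under `g`, and there exceeds `S` by at most the overlap.
      one-sided : (∀ φ → ℙ f.m⟦ φ ⟧ ≈ ℙ g.m⟦ φ ⟧) → ∀ {S} (mS : Generated G S) → ℙ (f.m* mS) ≤ ℙ (g.m* mS)
      one-sided agree {S} mS = ≤-up-to-ε em λ {ε} 0<ε →
        let φ , ψ , S⊆ , ∁S⊆ , ≤h = g.approximate mS (0<half 0<ε)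
            n , close = ℙ-continuous-from-below (λ n → f.m⟦ prefix G φ n ⟧) (λ n → prefix-suc em φ n)
                          (f.m* mS) (prefix⁺ em φ ∘ S⊆) (0<half 0<ε)
            mO = g.m-open φ
        in begin
          ℙ (f.m* mS)                                ≤⟨ close ⟩
          ℙ f.m⟦ prefix G φ n ⟧ + half ε             ≈⟨ +-congʳ (agree (prefix G φ n)) ⟩
          ℙ g.m⟦ prefix G φ n ⟧ + half ε             ≤⟨ +-mono-≤ (ℙ-mono _ mO (prefix⁻ em φ n)) ≤-refl ⟩
          ℙ mO + half ε                              ≈⟨ +-congʳ (ℙ-split mO (g.m* mS)) ⟩
          ℙ (mO ∩ᵐ g.m* mS) + ℙ (mO ∩ᵐ complement (g.m* mS)) + half ε
            ≤⟨ +-mono-≤ (+-mono-≤ (ℙ-mono _ (g.m* mS) proj₂)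
                                  (≤-trans (ℙ-mono _ (mO ∩ᵐ g.m-open ψ) (λ (x , ¬s) → x , ∁S⊆ ¬s)) ≤h)) ≤-refl ⟩
          ℙ (g.m* mS) + half ε + half ε              ≈⟨ trans (+-assoc _ _ _) (+-congˡ (half+half ε)) ⟩
          ℙ (g.m* mS) + ε                            ∎

  same-law : ∀ (f g : Outcome → A) (mf : ∀ {P} → G P → Measurable (P ∘ f)) (mg : ∀ {P} → G P → Measurable (P ∘ g)) →
             (∀ φ (mφf : Measurable (⟦_⟧ {G = G} φ ∘ f)) (mφg : Measurable (⟦ φ ⟧ ∘ g)) → ℙ mφf ≈ ℙ mφg) →
             ∀ {S} → Generated G S → (mSf : Measurable (S ∘ f)) (mSg : Measurable (S ∘ g)) → ℙ mSf ≈ ℙ mSg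
  same-law f g mf mg agree mS mSf mSg = trans (Pr-cong (id , id) _ _) (trans
    (antisym (one-sided f g mf mg (λ φ → agree φ _ _) mS) (one-sided g f mg mf (λ φ → sym (agree φ _ _)) mS))
    (Pr-cong (id , id) _ _))

-- Null sets from null sections

module NullSections (em : ∀ {ℓ} → ExcludedMiddle ℓ) (ℝ : CompleteOrderedField) {u} (𝒫 : ProbabilitySpace ℝ u)
                    (Ω : OrderedMeasurableSpace u) (X Y : RandomVariable 𝒫 Ω) where

  open CompleteOrderedField ℝ hiding (zero; refl)
  open RealProperties ℝ
  open ProbabilitySpace 𝒫 hiding (σ-algebra)
  open MeasurableSets em (ProbabilitySpace.σ-algebra 𝒫)
  open ProbabilityProperties em ℝ 𝒫
  open ≤-Reasoning
  private
    module Ω = OrderedMeasurableSpace Ω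
    module Ωᵐ where
      open σ-Algebra Ω.σ-algebra public
      open MeasurableSets em Ω.σ-algebra public

    G : Pred (Pred (Ω.Carrier × Ω.Carrier) u) (lsuc u)
    G = Rectangle Ω.σ-algebra Ω.σ-algebra

    XY : Outcome → Ω.Carrier × Ω.Carrier
    XY s = value X s , value Y s

    mXY : ∀ {P} → G P → Measurable (P ∘ XY)
    mXY (rectangle mP mQ) = measurable X mP ∩ᵐ measurable Y mQ

  open Approximation em ℝ 𝒫 {G = G} XY mXY

  section : Pred (Ω.Carrier × Ω.Carrier) u → Ω.Carrier → Pred Ω.Carrier u
  section S b a = S (a , b)

  section-measurable : ∀ {S} → Generated G S → ∀ b → Ω.Measurable (section S b)
  section-measurable mS b = preimage-measurable Ω.σ-algebra
    (λ { (rectangle {Q = Q} mP mQ) → mP Ωᵐ.∩ᵐ Ωᵐ.const-measurable (Q b) }) mS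

  sectionLaw : Formula G → Ω.Carrier → Carrier
  sectionLaw φ b = law X (section ⟦ φ ⟧ b) (section-measurable (formula-generated em φ) b)

  Cell : Set (lsuc u)
  Cell = Σ[ B ∈ Pred Ω.Carrier u ] Ω.Measurable B

  -- A cell stands for the strip of points whose second coordinate lies in `B`. A set respects this
  -- relation iff its sections at all points of `B` coincide.
  SameRow : Cell → Rel (Ω.Carrier × Ω.Carrier) u
  SameRow (B , _) (a , b) (a′ , b′) = a ≡ a′ × B b × B b′

  -- A strip is cut along the second factors of the rectangles in the formula until its sections no
  -- longer vary. The inclusion in the original strip is carried along so that bounds assumed there
  -- can be used on the pieces.
  refine-strips : ∀ {q} (Q : Cell → Set q) →
    (∀ {B D} (mB : Ω.Measurable B) (mD : Ω.Measurable D) →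
       Q (_ , mB Ωᵐ.∩ᵐ mD) → Q (_ , mB Ωᵐ.∩ᵐ Ωᵐ.complement mD) → Q (B , mB)) →
    ∀ (φ : Formula G) c → (∀ c′ → proj₁ c′ ⊆ proj₁ c → ⟦ φ ⟧ Respects SameRow c′ → Q c′) → Q c
  refine-strips Q glue φ c q =
    refine SameRow (λ _ (a≡ , b , b′) → ≡.sym a≡ , b′ , b) (λ c′ → proj₁ c′ ⊆ proj₁ c → Q c′) cut φ c
      (λ c′ _ φ-resp c′⊆c → q c′ c′⊆c φ-resp) id
    where
    cut : ∀ {P} → G P → ∀ c₁ →
          (∀ c′ → SameRow c′ ⇒ SameRow c₁ → P Respects SameRow c′ → proj₁ c′ ⊆ proj₁ c → Q c′) →
          proj₁ c₁ ⊆ proj₁ c → Q c₁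
    cut (rectangle {Q = D} mP mD) (B , mB) q′ B⊆ = glue mB mD
      (q′ (B ∩ D , mB Ωᵐ.∩ᵐ mD) (λ (a≡ , (b , _) , (b′ , _)) → a≡ , b , b′)
          (λ { (refl , _ , (_ , d′)) (p , _) → p , d′ }) (B⊆ ∘ proj₁))
      (q′ (B ∩ ∁ D , mB Ωᵐ.∩ᵐ Ωᵐ.complement mD) (λ (a≡ , (b , _) , (b′ , _)) → a≡ , b , b′)
          (λ { (refl , (_ , ¬d) , _) (_ , d) → ⊥-elim (¬d d) }) (B⊆ ∘ proj₁))

  constant-on-strip : ∀ (φ : Formula G) {B} {mB : Ω.Measurable B} → ⟦ φ ⟧ Respects SameRow (B , mB) →
                      ∀ {b b′} → B b → B b′ → section ⟦ φ ⟧ b ⊆ section ⟦ φ ⟧ b′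
  constant-on-strip φ φ-resp b b′ = φ-resp (refl , b , b′)

  sectionLaw-constant : ∀ (φ : Formula G) {B} {mB : Ω.Measurable B} → ⟦ φ ⟧ Respects SameRow (B , mB) →
                        ∀ {b b′} → B b → B b′ → sectionLaw φ b ≈ sectionLaw φ b′
  sectionLaw-constant φ {mB = mB} φ-resp b b′ = Pr-cong
    (constant-on-strip φ {mB = mB} φ-resp b b′ , constant-on-strip φ {mB = mB} φ-resp b′ b) _ _

  -- After refinement the section law is constant on each strip, so that each strip contributes
  -- either all of itself or nothing.
  sectionLaw-measurable : ∀ φ ε {B} → Ω.Measurable B → Ω.Measurable (λ b → B b × sectionLaw φ b ≤ ε)
  sectionLaw-measurable φ ε {B} mB =
    refine-strips (λ c → Ω.Measurable (λ b → proj₁ c b × sectionLaw φ b ≤ ε)) glue φ (B , mB) λ c _ → constant c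
    where
    glue : ∀ {B D} (mB : Ω.Measurable B) (mD : Ω.Measurable D) →
           Ω.Measurable (λ b → (B ∩ D) b × sectionLaw φ b ≤ ε) →
           Ω.Measurable (λ b → (B ∩ ∁ D) b × sectionLaw φ b ≤ ε) →
           Ω.Measurable (λ b → B b × sectionLaw φ b ≤ ε)
    glue {B} {D} _ _ m₁ m₂ = Ωᵐ.resp
      ([ (λ ((b , _) , ≤ε) → b , ≤ε) , (λ ((b , _) , ≤ε) → b , ≤ε) ]′ , from)
      (m₁ Ωᵐ.∪ᵐ m₂)
      where
      from : ∀ {b} → B b × sectionLaw φ b ≤ ε →
             ((B ∩ D) b × sectionLaw φ b ≤ ε) ⊎ ((B ∩ ∁ D) b × sectionLaw φ b ≤ ε)
      from {b} (Bb , ≤ε) with em {P = D b}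
      ... | yes d = inj₁ ((Bb , d) , ≤ε)
      ... | no ¬d = inj₂ ((Bb , ¬d) , ≤ε)
    constant : ∀ c → ⟦ φ ⟧ Respects SameRow c → Ω.Measurable (λ b → proj₁ c b × sectionLaw φ b ≤ ε)
    constant (B , mB) φ-resp with em {P = ∃[ b ] B b × sectionLaw φ b ≤ ε}
    ... | yes (b₀ , B₀ , ≤ε) = Ωᵐ.resp
      ((λ b → b , ≤-trans (≤-reflexive (sectionLaw-constant φ {mB = mB} φ-resp b B₀)) ≤ε) , proj₁) mB
    ... | no ¬∃ = Ωᵐ.resp ((λ ()) , (λ {b} x → ⊥-elim (¬∃ (b , x)))) Ωᵐ.∅-measurable

  module _ (independent : ∀ {P Q} (mP : Ω.Measurable P) (mQ : Ω.Measurable Q) →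
                          ℙ (measurable X mP ∩ᵐ measurable Y mQ) ≈ law X P mP * law Y Q mQ) where

    -- On a strip with constant sections the formula is a product set, where independence applies;
    -- both sides of the bound are additive over strips.
    ℙ-strip≤ : ∀ φ ε {B} (mB : Ω.Measurable B) → (∀ {b} → B b → sectionLaw φ b ≤ ε) →
               ℙ (m⟦ φ ⟧ ∩ᵐ measurable Y mB) ≤ ε * law Y B mB
    ℙ-strip≤ φ ε {B} mB ≤ε = refine-strips Q glue φ (B , mB) λ c c⊆B → constant c (≤ε ∘ c⊆B)
      where
      Q : Cell → Set
      Q (B , mB) = ℙ (m⟦ φ ⟧ ∩ᵐ measurable Y mB) ≤ ε * law Y B mB
      glue : ∀ {B D} (mB : Ω.Measurable B) (mD : Ω.Measurable D) →
             Q (_ , mB Ωᵐ.∩ᵐ mD) → Q (_ , mB Ωᵐ.∩ᵐ Ωᵐ.complement mD) → Q (B , mB)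
      glue mB mD q₁ q₂ = begin
        ℙ (m⟦ φ ⟧ ∩ᵐ measurable Y mB)
          ≈⟨ ℙ-split _ (measurable Y mD) ⟩
        ℙ ((m⟦ φ ⟧ ∩ᵐ measurable Y mB) ∩ᵐ measurable Y mD) +
        ℙ ((m⟦ φ ⟧ ∩ᵐ measurable Y mB) ∩ᵐ complement (measurable Y mD))
          ≤⟨ +-mono-≤ (≤-trans (ℙ-mono _ _ λ ((x , b) , d) → x , b , d) q₁)
                      (≤-trans (ℙ-mono _ _ λ ((x , b) , d) → x , b , d) q₂) ⟩
        ε * law Y _ (mB Ωᵐ.∩ᵐ mD) + ε * law Y _ (mB Ωᵐ.∩ᵐ Ωᵐ.complement mD)
          ≈⟨ distribˡ ε _ _ ⟨
        ε * (law Y _ (mB Ωᵐ.∩ᵐ mD) + law Y _ (mB Ωᵐ.∩ᵐ Ωᵐ.complement mD))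
          ≈⟨ *-congˡ (trans (ℙ-split (measurable Y mB) (measurable Y mD))
                            (+-cong (Pr-cong (id , id) _ _) (Pr-cong (id , id) _ _))) ⟨
        ε * law Y _ mB ∎
      constant : ∀ c → (∀ {b} → proj₁ c b → sectionLaw φ b ≤ ε) → ⟦ φ ⟧ Respects SameRow c → Q c
      constant (B , mB) ≤ε φ-resp with em {P = Satisfiable B}
      -- A point of the strip is needed to name the common section; over an empty strip both sides
      -- vanish.
      ... | yes (b₀ , B₀) = begin
        ℙ (m⟦ φ ⟧ ∩ᵐ measurable Y mB)
          ≈⟨ Pr-cong ((λ (x , b) → constant-on-strip φ {mB = mB} φ-resp b B₀ x , b)
                     , (λ (x , b) → constant-on-strip φ {mB = mB} φ-resp B₀ b x , b)) _ _ ⟩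
        ℙ (measurable X (section-measurable (formula-generated em φ) b₀) ∩ᵐ measurable Y mB)
          ≈⟨ independent _ mB ⟩
        sectionLaw φ b₀ * law Y B mB
          ≤⟨ *-monoʳ-≤ (Pr-nonNegative _) (≤ε B₀) ⟩
        ε * law Y B mB ∎
      ... | no ¬B = begin
        ℙ (m⟦ φ ⟧ ∩ᵐ measurable Y mB)  ≈⟨ ℙ-empty _ (λ _ (_ , b) → ¬B (_ , b)) ⟩
        0#                             ≈⟨ zeroʳ ε ⟨
        ε * 0#                         ≈⟨ *-congˡ (ℙ-empty (measurable Y mB) (λ _ b → ¬B (_ , b))) ⟨
        ε * law Y B mB                 ∎

    null-from-sections : ∀ {S} (mS : Generated G S) → (∀ b → law X _ (section-measurable mS b) ≈ 0#) →
                         ℙ (m* mS) ≈ 0#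
    null-from-sections {S} mS null =
      antisym (≤0-from-3ε em λ 0<ε → bound 0<ε (approximate mS 0<ε)) (Pr-nonNegative _)
      where
      bound : ∀ {ε} → 0# < ε → Approximable S ε → ℙ (m* mS) ≤ ε + ε + ε
      bound {ε} 0<ε (φ , ψ , S⊆φ , ∁S⊆ψ , overlap≤ε) = finish
        (ℙ-continuous-from-above (λ n → measurable Y (Ωᵐ.complement (mL n))) (λ n ¬l l → ¬l (L↗ n l))
          ∅-measurable (λ all → let n , l = L-exhausts _ in ⊥-elim (all n l)) 0<ε)
        where
        K : ℕ → Formula G
        -- The complement of a finite part of the cover of `∁ S`. The points of `S` outside `K n`
        -- lie in both covers, hence in their overlap.
        K n = not (prefix G ψ n)
        K↘ : ∀ n → ⟦ K (suc n) ⟧ ⊆ ⟦ K n ⟧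
        K↘ n ¬x x = ¬x (prefix-suc em ψ n x)
        ⋂K⊆S : ⋂ ℕ (⟦_⟧ ∘ K) ⊆ S
        ⋂K⊆S all = dne λ ¬s → let n , x = prefix⁺ em ψ (∁S⊆ψ ¬s) in all n x
        L : ℕ → Pred Ω.Carrier u
        L n b = ⊤ {u} × sectionLaw (K n) b ≤ ε
        mL : ∀ n → Ω.Measurable (L n)
        mL n = sectionLaw-measurable (K n) ε Ωᵐ.whole
        L↗ : ∀ n → L n ⊆ L (suc n)
        L↗ n {b} (_ , ≤ε) = tt , ≤-trans
          (ℙ-mono (measurable X (section-measurable (formula-generated em (K (suc n))) b))
                  (measurable X (section-measurable (formula-generated em (K n)) b)) (K↘ n)) ≤ε
        -- For fixed `b` the sections of `K n` decrease into the section of `S`, which is null, so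
        -- their laws eventually drop to ε.
        L-exhausts : ∀ b → ∃[ n ] L n b
        L-exhausts b =
          let n , close = ℙ-continuous-from-above
                (λ n → measurable X (section-measurable (formula-generated em (K n)) b)) (λ n → K↘ n)
                (measurable X (section-measurable mS b)) ⋂K⊆S 0<ε
          in n , tt , ≤-trans close (≤-reflexive (trans (+-congʳ (null b)) (+-identityˡ ε)))
        m-overlap = m-open φ ∩ᵐ m-open ψ
        finish : (∃[ n ] ℙ (measurable Y (Ωᵐ.complement (mL n))) ≤ ℙ ∅-measurable + ε) → ℙ (m* mS) ≤ ε + ε + ε
        finish (n , high≤) = begin
          ℙ (m* mS)
            ≤⟨ ℙ-mono (m* mS) ((m-low ∪ᵐ m-high) ∪ᵐ m-overlap) cover ⟩
          ℙ ((m-low ∪ᵐ m-high) ∪ᵐ m-overlap)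
            ≤⟨ ℙ-subadditive (m-low ∪ᵐ m-high) m-overlap _ ⟩
          ℙ (m-low ∪ᵐ m-high) + ℙ m-overlap
            ≤⟨ +-mono-≤ (ℙ-subadditive m-low m-high _) overlap≤ε ⟩
          ℙ m-low + ℙ m-high + ε
            ≤⟨ +-mono-≤ (+-mono-≤ low≤ (≤-trans high≤ (≤-reflexive (trans (+-congʳ ℙ-∅) (+-identityˡ ε))))) ≤-refl ⟩
          ε + ε + ε ∎
          where
          m-low = m⟦ K n ⟧ ∩ᵐ measurable Y (mL n)
          m-high = measurable Y (Ωᵐ.complement (mL n))
          -- The three pieces: points of `K n` over a small section, points over a large section,
          -- and points where the two covers overlap.
          cover : S ∘ XY ⊆ (((⟦ K n ⟧ ∘ XY) ∩ (value Y ⊢ L n)) ∪ (value Y ⊢ ∁ (L n))) ∪ ((Open φ ∘ XY) ∩ (Open ψ ∘ XY))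
          cover {s} x with em {P = ⟦ prefix G ψ n ⟧ (XY s)} | em {P = L n (value Y s)}
          ... | yes v | _     = inj₂ (S⊆φ x , prefix⁻ em ψ n v)
          ... | no ¬v | yes l = inj₁ (inj₁ (¬v , l))
          ... | no ¬v | no ¬l = inj₁ (inj₂ ¬l)
          low≤ : ℙ m-low ≤ ε
          low≤ = begin
            ℙ m-low              ≤⟨ ℙ-strip≤ (K n) ε (mL n) proj₂ ⟩
            ε * law Y _ (mL n)   ≈⟨ *-comm ε _ ⟩
            law Y _ (mL n) * ε
              ≤⟨ *-monoʳ-≤ (proj₁ 0<ε) (ℙ≤1 (measurable Y (mL n))) ⟩
            1# * ε               ≈⟨ *-identityˡ ε ⟩
            ε                    ∎

    private
      -- By trichotomy `≈` is the complement of `<` and its transpose; the transpose is measurable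
      -- because swapping coordinates maps rectangles to rectangles.
      ≈-generated : Generated G (uncurry Ω._≈_)
      ≈-generated = Ω².resp (to , from) (Ω².complement (Ω.<-measurable Ω².∪ᵐ
        preimage-measurable (generatedBy G) (λ { (rectangle mP mQ) →
          Ω².resp (swap , swap) (gen-basic (rectangle mQ mP)) }) Ω.<-measurable))
        where
        module Ω² where
          open σ-Algebra (generatedBy G) public
          open MeasurableSets em (generatedBy G) public
        to : ∁ (uncurry Ω._<_ ∪ (uncurry Ω._<_ ∘ swap)) ⊆ uncurry Ω._≈_
        to {a , b} ¬<> with Ω.compare a b
        ... | tri< a<b _ _ = ⊥-elim (¬<> (inj₁ a<b))
        ... | tri≈ _ a≈b _ = a≈b
        ... | tri> _ _ b<a = ⊥-elim (¬<> (inj₂ b<a))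
        from : uncurry Ω._≈_ ⊆ ∁ (uncurry Ω._<_ ∪ (uncurry Ω._<_ ∘ swap))
        from a≈b (inj₁ a<b) = Ω.irrefl a≈b a<b
        from a≈b (inj₂ b<a) = Ω.irrefl (Ω.Eq.sym a≈b) b<a

    ties-null : Continuous X → Σ[ m ∈ Measurable (λ s → value X s Ω.≈ value Y s) ] ℙ m ≈ 0#
    ties-null continuous = m* ≈-generated , null-from-sections ≈-generated λ b → continuous b _

-- Paths as permutations of the sample

-- Position 0 belongs to the last step of the path, in accordance with dealX and dealY.

place : ∀ {m n N} → Path m n → N ≡ m ℕ.+ n → Fin m ⊎ Fin n → Fin N
place         start         eq (inj₁ ())
place         start         eq (inj₂ ())
place {N = suc N} (right p) eq (inj₁ zero)    = zero
place {N = suc N} (right p) eq (inj₁ (suc i)) = suc (place p (ℕ.suc-injective eq) (inj₁ i))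
place {N = suc N} (right p) eq (inj₂ j)       = suc (place p (ℕ.suc-injective eq) (inj₂ j))
place {N = zero} (up {a} {c} p) eq _          = contradiction (≡.trans eq (ℕ.+-suc a c)) λ ()
place {N = suc N} (up {a} {c} p) eq (inj₁ i)       =
  suc (place p (pred-+-suc a c eq) (inj₁ i))
place {N = suc N} (up p)    eq (inj₂ zero)    = zero
place {N = suc N} (up {a} {c} p) eq (inj₂ (suc j)) =
  suc (place p (pred-+-suc a c eq) (inj₂ j))

-- The length `N` is tied to `m + n` by an equation because `m + suc n` does not compute to a
-- successor when the last step is `up`.
unplace : ∀ {m n N} → Path m n → N ≡ m ℕ.+ n → Fin N → Fin m ⊎ Fin n
unplace {N = suc N} start     ()
unplace {N = suc N} (right p) eq zero    = inj₁ zero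
unplace {N = suc N} (right p) eq (suc i) = Sum.map₁ suc (unplace p (ℕ.suc-injective eq) i)
unplace {N = suc N} (up p)    eq zero    = inj₂ zero
unplace {N = suc N} (up {a} {c} p) eq (suc i) =
  Sum.map₂ suc (unplace p (pred-+-suc a c eq) i)

place-unplace : ∀ {m n N} (p : Path m n) (eq : N ≡ m ℕ.+ n) i → place p eq (unplace p eq i) ≡ i
place-unplace {N = suc N} start     ()
place-unplace {N = suc N} (right p) eq zero    = refl
place-unplace {N = suc N} (right p) eq (suc i)
  with unplace p (ℕ.suc-injective eq) i | place-unplace p (ℕ.suc-injective eq) i
... | inj₁ _ | ih = ≡.cong suc ih
... | inj₂ _ | ih = ≡.cong suc ih
place-unplace {N = suc N} (up p)    eq zero    = refl
place-unplace {N = suc N} (up {a} {c} p) eq (suc i)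
  with unplace p (pred-+-suc a c eq) i
     | place-unplace p (pred-+-suc a c eq) i
... | inj₁ _ | ih = ≡.cong suc ih
... | inj₂ _ | ih = ≡.cong suc ih

unplace-place : ∀ {m n N} (p : Path m n) (eq : N ≡ m ℕ.+ n) i → unplace p eq (place p eq i) ≡ i
unplace-place         start         eq (inj₁ ())
unplace-place         start         eq (inj₂ ())
unplace-place {N = suc N} (right p) eq (inj₁ zero)    = refl
unplace-place {N = suc N} (right p) eq (inj₁ (suc i)) =
  ≡.cong (Sum.map₁ suc) (unplace-place p (ℕ.suc-injective eq) (inj₁ i))
unplace-place {N = suc N} (right p) eq (inj₂ j) =
  ≡.cong (Sum.map₁ suc) (unplace-place p (ℕ.suc-injective eq) (inj₂ j))
unplace-place {N = zero} (up {a} {c} p) eq _          = contradiction (≡.trans eq (ℕ.+-suc a c)) λ ()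
unplace-place {N = suc N} (up {a} {c} p) eq (inj₁ i)       =
  ≡.cong (Sum.map₂ suc) (unplace-place p (pred-+-suc a c eq) (inj₁ i))
unplace-place {N = suc N} (up p)    eq (inj₂ zero)    = refl
unplace-place {N = suc N} (up {a} {c} p) eq (inj₂ (suc j)) =
  ≡.cong (Sum.map₂ suc) (unplace-place p (pred-+-suc a c eq) (inj₂ j))

-- Reindexing a vector by this permutation brings the entries that `p` deals to the xs to the first
-- `m` places and those dealt to the ys to the last `n`.
placement : ∀ {m n} → Path m n → Permutation (m ℕ.+ n) (m ℕ.+ n)
placement p = mk↔ₛ′ (place p refl) (unplace p refl) (place-unplace p refl) (unplace-place p refl) ↔-∘ Fin.+↔⊎

module _ {a} {A : Set a} where

  dealX-tabulate : ∀ {m n N} (p : Path m n) (eq : N ≡ m ℕ.+ n) (z : Vector A N) →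
                   tabulate (z ∘ place p eq ∘ inj₁) ≡ dealX p (tabulate z)
  dealX-tabulate {N = zero}  start          eq z = refl
  dealX-tabulate {N = zero}  (up {a} {c} p) eq z = contradiction (≡.trans eq (ℕ.+-suc a c)) λ ()
  dealX-tabulate {N = suc N} (right p)      eq z = ≡.cong (z zero ∷_) (dealX-tabulate p _ (z ∘ suc))
  dealX-tabulate {N = suc N} (up p)         eq z = dealX-tabulate p _ (z ∘ suc)

  dealY-tabulate : ∀ {m n N} (p : Path m n) (eq : N ≡ m ℕ.+ n) (z : Vector A N) →
                   tabulate (z ∘ place p eq ∘ inj₂) ≡ dealY p (tabulate z)
  dealY-tabulate {N = zero}  start          eq z = refl
  dealY-tabulate {N = zero}  (up {a} {c} p) eq z = contradiction (≡.trans eq (ℕ.+-suc a c)) λ ()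
  dealY-tabulate {N = suc N} (right p)      eq z = dealY-tabulate p _ (z ∘ suc)
  dealY-tabulate {N = suc N} (up p)         eq z = ≡.cong (z zero ∷_) (dealY-tabulate p _ (z ∘ suc))

  placement-X : ∀ {m n} (p : Path m n) (z : Vector A (m ℕ.+ n)) →
                tabulate (λ i → z (placement p ⟨$⟩ʳ (i ↑ˡ n))) ≡ dealX p (tabulate z)
  placement-X {m} {n} p z = ≡.trans
    (tabulate-cong λ i → ≡.cong (z ∘ place p refl) (Fin.splitAt-↑ˡ m i n)) (dealX-tabulate p refl z)

  placement-Y : ∀ {m n} (p : Path m n) (z : Vector A (m ℕ.+ n)) →
                tabulate (λ j → z (placement p ⟨$⟩ʳ (m ↑ʳ j))) ≡ dealY p (tabulate z)
  placement-Y {m} {n} p z = ≡.trans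
    (tabulate-cong λ j → ≡.cong (z ∘ place p refl) (Fin.splitAt-↑ʳ m n j)) (dealY-tabulate p refl z)

length-filter-map : ∀ {i j p} {I : Set i} {J : Set j} {P : Pred J p} (P? : Decidable P) (f : I → J) xs →
                    length (filter P? (map f xs)) ≡ length (filter (P? ∘ f) xs)
length-filter-map P? f []       = refl
length-filter-map P? f (x ∷ xs) with P? (f x)
... | yes _ = ≡.cong suc (length-filter-map P? f xs)
... | no  _ = length-filter-map P? f xs

-- Measurability of comparisons of order statistics

module _ {u} (Ω : OrderedMeasurableSpace u) where

  private
    module Ω = OrderedMeasurableSpace Ω

  data Cylinder N : Pred (Pred (Vector Ω.Carrier N) u) (lsuc u) where
    cylinder : ∀ i {P} → Ω.Measurable P → Cylinder N (λ z → P (z i))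

module CylinderSets (em : ∀ {ℓ} → ExcludedMiddle ℓ) {u} (Ω : OrderedMeasurableSpace u) {N : ℕ} where

  private
    module Ω = OrderedMeasurableSpace Ω
    O = Ω.strictTotalOrder
  open OrderStatistics O
  open DecTotalOrder (STOProperties.decTotalOrder O) using (_≤_; _≤?_)

  open σ-Algebra (generatedBy (Cylinder Ω N))
  open MeasurableSets em (generatedBy (Cylinder Ω N))

  <-cylinder : ∀ i j → Measurable (λ z → z i Ω.< z j)
  <-cylinder i j = preimage-measurable (generatedBy (Cylinder Ω N)) {f = λ z → z i , z j}
    (λ { (rectangle mP mQ) → gen-basic (cylinder i mP) ∩ᵐ gen-basic (cylinder j mQ) }) Ω.<-measurable

  ≤-cylinder : ∀ i j → Measurable (λ z → z i ≤ z j)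
  ≤-cylinder i j = resp ((λ z≮ → dne λ z≰ → z≮ (≰⇒> z≰)) , (λ z≤ z> → <⇒≱ z> z≤)) (complement (<-cylinder j i))

  rank-measurable : ∀ {k} (f : Fin k → Fin N) j (R : Pred ℕ u) →
                    Measurable (λ z → R (rank (z j) (tabulate (z ∘ f))))
  rank-measurable {k} f j R = resp ((λ {z} → ≡.subst R (≡.sym (eq z))) , (λ {z} → ≡.subst R (eq z)))
    (length-filter-measurable (λ z i → z (f i) ≤? z j) (λ _ _ → id) (λ _ _ → id) (λ i → ≤-cylinder (f i) j)
                              (allFin k) R)
    where
    eq : ∀ z → rank (z j) (tabulate (z ∘ f)) ≡ length (filter (λ i → z (f i) ≤? z j) (allFin k))
    eq z = ≡.trans (≡.cong (λ xs → length (filter (_≤? z j) xs)) (≡.sym (map-tabulate id (z ∘ f))))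
                   (length-filter-map (_≤? z j) (z ∘ f) (allFin k))

  Below-measurable : ∀ {m n} t (f : Fin m → Fin N) (g : Fin n → Fin N) →
                     Measurable (λ z → Below t (tabulate (z ∘ f)) (tabulate (z ∘ g)))
  Below-measurable t f g = resp
    ( (λ (i , t< , ≤t) → Any.tabulate⁺ i (lower t< , lower ≤t))
    , λ {z} → unlift z)
    (⋃-Fin-measurable λ i → rank-measurable f (f i) (λ r → Lift u (t ℕ.< r)) ∩ᵐ
                              rank-measurable g (f i) (λ r → Lift u (r ℕ.≤ t)))
    where
    unlift : ∀ z → Below t (tabulate (z ∘ f)) (tabulate (z ∘ g)) →
             ∃[ i ] Lift u (t ℕ.< rank (z (f i)) (tabulate (z ∘ f))) ×
                    Lift u (rank (z (f i)) (tabulate (z ∘ g)) ℕ.≤ t)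
    unlift z b with i , t< , ≤t ← Any.tabulate⁻ {f = z ∘ f} b = i , lift t< , lift ≤t

  -- The sorted list is not examined: each comparison of order statistics is replaced by `Below`, a
  -- finite combination of comparisons between coordinates.
  countBelow-measurable : ∀ {m n} k k≤m k≤n (f : Fin m → Fin N) (g : Fin n → Fin N) (R : Pred ℕ u) →
                          Measurable (λ z → R (countBelow O k k≤m k≤n (z ∘ f) (z ∘ g)))
  countBelow-measurable k k≤m k≤n f g R = length-filter-measurable
    (λ z i → orderStatistic O (z ∘ f) (inject≤ i k≤m) Ω.<? orderStatistic O (z ∘ g) (inject≤ i k≤n))
    (λ i z → Equivalence.to (orderStatistic-inject≤-< k≤m k≤n (z ∘ f) (z ∘ g) i))
    (λ i z → Equivalence.from (orderStatistic-inject≤-< k≤m k≤n (z ∘ f) (z ∘ g) i))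
    (λ i → Below-measurable (toℕ i) f g) (allFin k) R

-- Joint laws and exchangeability

module JointLaws (em : ∀ {ℓ} → ExcludedMiddle ℓ) (ℝ : CompleteOrderedField) {u} (𝒫 : ProbabilitySpace ℝ u)
                 (Ω : OrderedMeasurableSpace u) {N : ℕ} where

  open CompleteOrderedField ℝ hiding (zero; refl)
  open RealProperties ℝ
  open ProbabilitySpace 𝒫 hiding (σ-algebra)
  open MeasurableSets em (ProbabilitySpace.σ-algebra 𝒫)
  open ProbabilityProperties em ℝ 𝒫
  open ≤-Reasoning
  private
    module Ω = OrderedMeasurableSpace Ω
    module Ωᵐ where
      open σ-Algebra Ω.σ-algebra public
      open MeasurableSets em Ω.σ-algebra public
    module ∏ = CommutativeMonoidSum *-commutativeMonoid

    RV : Set (lsuc u)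
    RV = RandomVariable 𝒫 Ω

  joint : Vector RV N → Outcome → Vector Ω.Carrier N
  joint Z s i = value (Z i) s

  joint-measurable : ∀ Z {P} → Cylinder Ω N P → Measurable (P ∘ joint Z)
  joint-measurable Z (cylinder i mP) = measurable (Z i) mP

  box-measurable : ∀ (Z : Vector RV N) {A : Fin N → Pred Ω.Carrier u} → (∀ i → Ω.Measurable (A i)) →
                   Measurable (⋂ (Fin N) (λ i → value (Z i) ⊢ A i))
  box-measurable Z mA = ⋂-Fin-measurable λ i → measurable (Z i) (mA i)

  -- The constraint `P` on coordinate `i` and none elsewhere, so that a condition on one coordinate
  -- becomes a box.
  at : Fin N → Pred Ω.Carrier u → Fin N → Pred Ω.Carrier u
  at i P k ω = k ≡ i → P ω

  abstract

    at-measurable : ∀ i {P} → Ω.Measurable P → ∀ k → Ω.Measurable (at i P k)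
    at-measurable i mP k with k Fin.≟ i
    ... | yes k≡i = Ωᵐ.resp ((λ p _ → p) , (λ p → p k≡i)) mP
    ... | no k≢i  = Ωᵐ.resp ((λ _ k≡i → ⊥-elim (k≢i k≡i)) , (λ _ → tt)) Ωᵐ.whole

  law-whole : ∀ (X : RV) {A} (mA : Ω.Measurable A) → (∀ ω → A ω) → law X A mA ≈ 1#
  law-whole X mA all = trans (Pr-cong ((λ _ → tt) , (λ _ → all _)) _ whole) Pr-whole

  pairwise-independent : ∀ {Z : Vector RV N} → Independent Z → ∀ {i j} → i ≢ j →
                         ∀ {P Q} (mP : Ω.Measurable P) (mQ : Ω.Measurable Q) →
                         ℙ (measurable (Z i) mP ∩ᵐ measurable (Z j) mQ) ≈ law (Z i) P mP * law (Z j) Q mQ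
  pairwise-independent {Z} independent {i} {j} i≢j {P} {Q} mP mQ = begin-equality
    ℙ (measurable (Z i) mP ∩ᵐ measurable (Z j) mQ)
      ≈⟨ Pr-cong ((λ { (p , q) k → (λ { refl → p }) , (λ { refl → q }) }) ,
                  (λ pq → proj₁ (pq i) refl , proj₂ (pq j) refl))
                 _ (box-measurable Z both) ⟩
    ℙ (box-measurable Z both)
      ≈⟨ independent _ both _ ⟩
    ∏ (λ k → law (Z k) _ (both k))
      ≈⟨ ∏.sum-cong-≋ factor ⟩
    ∏ (λ k → law (Z k) _ (at-measurable i mP k) * law (Z k) _ (at-measurable j mQ k))
      ≈⟨ ∏.∑-distrib-+ (λ k → law (Z k) _ (at-measurable i mP k)) (λ k → law (Z k) _ (at-measurable j mQ k)) ⟩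
    ∏ (λ k → law (Z k) _ (at-measurable i mP k)) * ∏ (λ k → law (Z k) _ (at-measurable j mQ k))
      ≈⟨ *-cong (single i mP) (single j mQ) ⟩
    law (Z i) P mP * law (Z j) Q mQ ∎
    where
    both : ∀ k → Ω.Measurable (at i P k ∩ at j Q k)
    both k = at-measurable i mP k Ωᵐ.∩ᵐ at-measurable j mQ k
    -- Independence read backwards: the product is the probability of a box with a single effective
    -- constraint.
    single : ∀ i {P} (mP : Ω.Measurable P) → ∏ (λ k → law (Z k) _ (at-measurable i mP k)) ≈ law (Z i) P mP
    single i mP = trans (sym (independent _ (at-measurable i mP) (box-measurable Z (at-measurable i mP))))
      (Pr-cong ((λ p → p i refl) , (λ { p _ refl → p })) _ _)
    -- As i ≢ j, at least one of the two constraints on coordinate `k` is vacuous and contributes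
    -- the factor 1.
    factor : ∀ k → law (Z k) _ (both k) ≈ law (Z k) _ (at-measurable i mP k) * law (Z k) _ (at-measurable j mQ k)
    factor k with k Fin.≟ i
    ... | yes refl = begin-equality
      law (Z k) _ (both k)                       ≈⟨ Pr-cong (proj₁ , λ p → p , λ k≡j → ⊥-elim (i≢j k≡j)) _ _ ⟩
      law (Z k) _ (at-measurable k mP k)         ≈⟨ *-identityʳ _ ⟨
      law (Z k) _ (at-measurable k mP k) * 1#
        ≈⟨ *-congˡ (law-whole (Z k) (at-measurable j mQ k) λ _ k≡j → ⊥-elim (i≢j k≡j)) ⟨
      law (Z k) _ (at-measurable k mP k) * law (Z k) _ (at-measurable j mQ k) ∎
    ... | no k≢i = begin-equality
      law (Z k) _ (both k)                       ≈⟨ Pr-cong (proj₂ , λ q → (λ k≡i → ⊥-elim (k≢i k≡i)) , q) _ _ ⟩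
      law (Z k) _ (at-measurable j mQ k)         ≈⟨ *-identityˡ _ ⟨
      1# * law (Z k) _ (at-measurable j mQ k)
        ≈⟨ *-congʳ (law-whole (Z k) (at-measurable i mP k) λ _ k≡i → ⊥-elim (k≢i k≡i)) ⟨
      law (Z k) _ (at-measurable i mP k) * law (Z k) _ (at-measurable j mQ k) ∎

  SameBoxLaw : Vector RV N → Vector RV N → Set (lsuc u)
  SameBoxLaw Z Z′ = ∀ {A : Fin N → Pred Ω.Carrier u} (mA : ∀ i → Ω.Measurable (A i)) →
                    ℙ (box-measurable Z mA) ≈ ℙ (box-measurable Z′ mA)

  permuted-box-law : ∀ {Z} → Independent Z → IdenticallyDistributed Z → ∀ (π : Permutation N N) →
                     SameBoxLaw (Z ∘ (π ⟨$⟩ʳ_)) Z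
  permuted-box-law {Z} independent identical π {A} mA = begin-equality
    ℙ (box-measurable (Z ∘ (π ⟨$⟩ʳ_)) mA)
      ≈⟨ Pr-cong ((λ {s} a i → ≡.subst (λ k → A (π ⟨$⟩ˡ i) (value (Z k) s)) (inverseʳ π) (a (π ⟨$⟩ˡ i)))
                 , (λ {s} a i → ≡.subst (λ k → A k (value (Z (π ⟨$⟩ʳ i)) s)) (inverseˡ π) (a (π ⟨$⟩ʳ i)))) _ _ ⟩
    ℙ (box-measurable Z (λ i → mA (π ⟨$⟩ˡ i)))
      ≈⟨ independent _ (λ i → mA (π ⟨$⟩ˡ i)) _ ⟩
    ∏ (λ i → law (Z i) _ (mA (π ⟨$⟩ˡ i)))
      -- Replacing the variable at `i` by the one at the preimage of `i` gives variable and set the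
      -- same index, and the product becomes a rearrangement of the original one.
      ≈⟨ ∏.sum-cong-≋ (λ i → identical i (π ⟨$⟩ˡ i) _ (mA (π ⟨$⟩ˡ i))) ⟩
    ∏ (λ i → law (Z (π ⟨$⟩ˡ i)) _ (mA (π ⟨$⟩ˡ i)))
      ≈⟨ ∏.sum-permute (λ k → law (Z k) _ (mA k)) (Perm.flip π) ⟨
    ∏ (λ k → law (Z k) _ (mA k))
      ≈⟨ independent _ mA _ ⟨
    ℙ (box-measurable Z mA) ∎

  module _ {Z Z′ : Vector RV N} (same : SameBoxLaw Z Z′) where

    private
      Cell : Set (lsuc u)
      Cell = Σ[ A ∈ (Fin N → Pred Ω.Carrier u) ] (∀ i → Ω.Measurable (A i))

      -- A set respects this relation iff it contains the whole box or misses it.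
      SameBox : Cell → Rel (Vector Ω.Carrier N) u
      SameBox (A , _) z z′ = (∀ i → A i (z i)) × (∀ i → A i (z′ i))

      restrict : Cell → ∀ i {P} → Ω.Measurable P → Cell
      restrict (A , mA) i {P} mP = (λ k → A k ∩ at i P k) , (λ k → mA k Ωᵐ.∩ᵐ at-measurable i mP k)

      same-formula-law : ∀ (φ : Formula (Cylinder Ω N)) (mφ : Measurable (⟦ φ ⟧ ∘ joint Z))
                         (mφ′ : Measurable (⟦ φ ⟧ ∘ joint Z′)) → ℙ mφ ≈ ℙ mφ′
      same-formula-law φ mφ mφ′ = begin-equality
        ℙ mφ                                       ≈⟨ Pr-cong ((λ x → x , λ _ → tt) , proj₁) _ _ ⟩
        ℙ (mφ ∩ᵐ box-measurable Z (λ _ → Ωᵐ.whole))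
          ≈⟨ refine SameBox (λ _ (a , b) → b , a) Q cut φ ((λ _ _ → ⊤) , λ _ → Ωᵐ.whole) (λ c _ → constant c) ⟩
        ℙ (mφ′ ∩ᵐ box-measurable Z′ (λ _ → Ωᵐ.whole))  ≈⟨ Pr-cong ((λ x → x , λ _ → tt) , proj₁) _ _ ⟨
        ℙ mφ′                                      ∎
        where
        Q : Cell → Set
        Q (A , mA) = ℙ (mφ ∩ᵐ box-measurable Z mA) ≈ ℙ (mφ′ ∩ᵐ box-measurable Z′ mA)
        split : ∀ (Z : Vector RV N) (mφ : Measurable (⟦ φ ⟧ ∘ joint Z)) c i {P} (mP : Ω.Measurable P) →
                ℙ (mφ ∩ᵐ box-measurable Z (proj₂ c)) ≈
                ℙ (mφ ∩ᵐ box-measurable Z (proj₂ (restrict c i mP))) +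
          ℙ (mφ ∩ᵐ box-measurable Z (proj₂ (restrict c i (Ωᵐ.complement mP))))
        split Z mφ c i {P} mP = trans (ℙ-split _ (measurable (Z i) mP))
                                      (+-cong (Pr-cong inside _ _) (Pr-cong outside _ _))
          where
          inside : (((⟦ φ ⟧ ∘ joint Z) ∩ ⋂ (Fin N) (λ k → value (Z k) ⊢ proj₁ c k)) ∩ (value (Z i) ⊢ P)) ≐
                   ((⟦ φ ⟧ ∘ joint Z) ∩ ⋂ (Fin N) (λ k → value (Z k) ⊢ (proj₁ c k ∩ at i P k)))
          inside = (λ ((x , a) , p) → x , λ k → a k , λ { refl → p }) ,
                   (λ (x , ap) → (x , proj₁ ∘ ap) , proj₂ (ap i) refl)
          outside : (((⟦ φ ⟧ ∘ joint Z) ∩ ⋂ (Fin N) (λ k → value (Z k) ⊢ proj₁ c k)) ∩ ∁ (value (Z i) ⊢ P)) ≐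
                    ((⟦ φ ⟧ ∘ joint Z) ∩ ⋂ (Fin N) (λ k → value (Z k) ⊢ (proj₁ c k ∩ at i (∁ P) k)))
          outside = (λ ((x , a) , p) → x , λ k → a k , λ { refl → p }) ,
                   (λ (x , ap) → (x , proj₁ ∘ ap) , proj₂ (ap i) refl)
        cut : ∀ {P} → Cylinder Ω N P → ∀ c → (∀ c′ → SameBox c′ ⇒ SameBox c → P Respects SameBox c′ → Q c′) → Q c
        cut (cylinder i mP) c q = begin-equality
          ℙ (mφ ∩ᵐ box-measurable Z (proj₂ c))
            ≈⟨ split Z mφ c i mP ⟩
          ℙ (mφ ∩ᵐ box-measurable Z (proj₂ (restrict c i mP))) +
          ℙ (mφ ∩ᵐ box-measurable Z (proj₂ (restrict c i (Ωᵐ.complement mP))))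
            ≈⟨ +-cong (q (restrict c i mP) (λ (a , a′) → proj₁ ∘ a , proj₁ ∘ a′) (λ (_ , a′) _ → proj₂ (a′ i) refl))
                      (q (restrict c i (Ωᵐ.complement mP)) (λ (a , a′) → proj₁ ∘ a , proj₁ ∘ a′)
                         (λ (a , _) p → ⊥-elim (proj₂ (a i) refl p))) ⟩
          ℙ (mφ′ ∩ᵐ box-measurable Z′ (proj₂ (restrict c i mP))) +
          ℙ (mφ′ ∩ᵐ box-measurable Z′ (proj₂ (restrict c i (Ωᵐ.complement mP))))
            ≈⟨ split Z′ mφ′ c i mP ⟨
          ℙ (mφ′ ∩ᵐ box-measurable Z′ (proj₂ c)) ∎
        constant : ∀ c → ⟦ φ ⟧ Respects SameBox c → Q c
        -- A formula that meets the box contains it, so both sides are probabilities of the box;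
        -- otherwise both sides are 0.
        constant (A , mA) φ-resp with em {P = ∃[ z ] (⟦ φ ⟧ z × (∀ i → A i (z i)))}
        ... | yes (z , x , a) = begin-equality
          ℙ (mφ ∩ᵐ box-measurable Z mA)    ≈⟨ Pr-cong (proj₂ , λ a′ → φ-resp (a , a′) x , a′) _ _ ⟩
          ℙ (box-measurable Z mA)          ≈⟨ same mA ⟩
          ℙ (box-measurable Z′ mA)         ≈⟨ Pr-cong (proj₂ , λ a′ → φ-resp (a , a′) x , a′) _ _ ⟨
          ℙ (mφ′ ∩ᵐ box-measurable Z′ mA)  ∎
        ... | no ¬∃ = trans (ℙ-empty _ λ _ (x , a) → ¬∃ (_ , x , a)) (sym (ℙ-empty _ λ _ (x , a) → ¬∃ (_ , x , a)))

    same-joint-law : ∀ {S} → Generated (Cylinder Ω N) S →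
                     (m : Measurable (S ∘ joint Z)) (m′ : Measurable (S ∘ joint Z′)) → ℙ m ≈ ℙ m′
    same-joint-law = same-law em ℝ 𝒫 (joint Z) (joint Z′) (joint-measurable Z) (joint-measurable Z′) same-formula-law

  exchangeable : ∀ {Z} → Independent Z → IdenticallyDistributed Z → ∀ (π : Permutation N N) →
                 ∀ {S} → Generated (Cylinder Ω N) S →
                 (m : Measurable (S ∘ joint (Z ∘ (π ⟨$⟩ʳ_)))) (m′ : Measurable (S ∘ joint Z)) → ℙ m ≈ ℙ m′
  exchangeable {Z} independent identical π =
    same-joint-law {Z ∘ (π ⟨$⟩ʳ_)} {Z} λ mA → permuted-box-law {Z} independent identical π mA

  Distinct : Vector RV N → Pred Outcome u
  Distinct Z s = ∀ i j → i ≢ j → ¬ value (Z i) s Ω.≈ value (Z j) s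

  distinct-almostSure : ∀ {Z} → (∀ i → Continuous (Z i)) → Independent Z →
                        AlmostSure (Distinct Z)
  distinct-almostSure {Z} continuous independent = almostSure-⋂ λ i → almostSure-⋂ λ j → off-diagonal i j
    where
    off-diagonal : ∀ i j → AlmostSure (λ s → i ≢ j → ¬ value (Z i) s Ω.≈ value (Z j) s)
    off-diagonal i j with i Fin.≟ j
    ... | yes i≡j = resp E≐ whole , trans (Pr-cong (proj₂ E≐ , proj₁ E≐) _ whole) Pr-whole
      where
      E≐ : (λ _ → ⊤) ≐ (λ s → i ≢ j → ¬ value (Z i) s Ω.≈ value (Z j) s)
      E≐ = (λ _ i≢j → ⊥-elim (i≢j i≡j)) , λ _ → tt
    ... | no i≢j = resp E≐ (complement (proj₁ tie)) , (begin-equality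
      ℙ (resp E≐ (complement (proj₁ tie)))            ≈⟨ Pr-cong (proj₂ E≐ , proj₁ E≐) _ _ ⟩
      ℙ (complement (proj₁ tie))                      ≈⟨ +-identityˡ _ ⟨
      0# + ℙ (complement (proj₁ tie))                 ≈⟨ +-congʳ (proj₂ tie) ⟨
      ℙ (proj₁ tie) + ℙ (complement (proj₁ tie))      ≈⟨ ℙ-complement (proj₁ tie) ⟩
      1#                                              ∎)
      where
      tie = NullSections.ties-null em ℝ 𝒫 Ω (Z i) (Z j)
        (λ mP mQ → pairwise-independent {Z} independent i≢j mP mQ) (continuous i)
      E≐ : ∁ (λ s → value (Z i) s Ω.≈ value (Z j) s) ≐ (λ s → i ≢ j → ¬ value (Z i) s Ω.≈ value (Z j) s)
      E≐ = (λ ≉ _ → ≉) , (λ ≉ → ≉ i≢j)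

-- Double counting with probabilities

module DoubleCounting (em : ∀ {ℓ} → ExcludedMiddle ℓ) (ℝ : CompleteOrderedField) {u} (𝒫 : ProbabilitySpace ℝ u) where

  open CompleteOrderedField ℝ hiding (zero; refl)
  open RealProperties ℝ hiding (total)
  open ProbabilitySpace 𝒫
  open MeasurableSets em σ-algebra
  open ProbabilityProperties em ℝ 𝒫
  open ≤-Reasoning
  open CommutativeSemigroupProperties +-commutativeSemigroup using (interchange; x∙yz≈y∙xz)

  module _ {i} {I : Set i} {E : I → Pred Outcome u} (mE : ∀ i → Measurable (E i)) where

    -- The expected number, over the event `D`, of those `E i` that occur. The restriction to `D`
    -- lets an induction cut the event along the sets already treated.
    total : List I → ∀ {D} → Measurable D → Carrier
    total []       mD = 0#
    total (i ∷ is) mD = ℙ (mD ∩ᵐ mE i) + total is mD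

    total-split : ∀ is {D F} (mD : Measurable D) (mF : Measurable F) →
                  total is mD ≈ total is (mD ∩ᵐ mF) + total is (mD ∩ᵐ complement mF)
    total-split []       mD mF = sym (+-identityˡ 0#)
    total-split (i ∷ is) mD mF = begin-equality
      ℙ (mD ∩ᵐ mE i) + total is mD
        ≈⟨ +-cong (trans (ℙ-split (mD ∩ᵐ mE i) mF) (+-cong (Pr-cong exchange _ _) (Pr-cong exchange _ _)))
                 (total-split is mD mF) ⟩
      (ℙ ((mD ∩ᵐ mF) ∩ᵐ mE i) + ℙ ((mD ∩ᵐ complement mF) ∩ᵐ mE i)) +
      (total is (mD ∩ᵐ mF) + total is (mD ∩ᵐ complement mF))
        ≈⟨ interchange _ _ _ _ ⟩
      (ℙ ((mD ∩ᵐ mF) ∩ᵐ mE i) + total is (mD ∩ᵐ mF)) +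
      (ℙ ((mD ∩ᵐ complement mF) ∩ᵐ mE i) + total is (mD ∩ᵐ complement mF)) ∎
      where
      exchange : ∀ {P Q R : Pred Outcome u} → ((P ∩ Q) ∩ R) ≐ ((P ∩ R) ∩ Q)
      exchange = (λ ((p , q) , r) → (p , r) , q) , (λ ((p , r) , q) → (p , q) , r)

    total-empty : ∀ is {D} (mD : Measurable D) → Empty D → total is mD ≈ 0#
    total-empty []       mD ¬D = CompleteOrderedField.refl ℝ
    total-empty (i ∷ is) mD ¬D = trans (+-cong (ℙ-empty _ λ _ (d , _) → ¬D _ d) (total-empty is mD ¬D)) (+-identityˡ 0#)

    total-constant : ∀ is {D q} (mD : Measurable D) → (∀ i → ℙ (mD ∩ᵐ mE i) ≈ q) → total is mD ≈ fromℕ (length is) * q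
    total-constant []       {q = q} mD eq = sym (zeroˡ q)
    total-constant (i ∷ is) {q = q} mD eq = begin-equality
      ℙ (mD ∩ᵐ mE i) + total is mD
        ≈⟨ +-cong (trans (eq i) (sym (*-identityˡ q))) (total-constant is mD eq) ⟩
      1# * q + fromℕ (length is) * q         ≈⟨ distribʳ q 1# (fromℕ (length is)) ⟨
      fromℕ (suc (length is)) * q            ∎

    -- `D` is cut along the event of the head: inside it the remaining events must occur one time
    -- fewer, outside it the count is unchanged.
    total-count : (E? : ∀ s → Decidable (λ i → E i s)) → ∀ is c {D} (mD : Measurable D) →
                  (∀ {s} → D s → length (filter (E? s) is) ≡ c) →
                  total is mD ≈ fromℕ c * ℙ mD
    total-count E? []       zero    mD count = sym (zeroˡ _)
    -- No event is left although some are still due, so `D` is empty.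
    total-count E? []       (suc c) mD count =
      sym (trans (*-congˡ (ℙ-empty mD λ _ d → contradiction (count d) λ ())) (zeroʳ _))
    total-count E? (i ∷ is) c {D} mD count = begin-equality
      ℙ mDE + total is mD                                       ≈⟨ +-congˡ (total-split is mD (mE i)) ⟩
      ℙ mDE + (total is mDE + total is mD∁E)                    ≈⟨ +-assoc _ _ _ ⟨
      (ℙ mDE + total is mDE) + total is mD∁E
        ≈⟨ +-cong (hit c count) (total-count E? is c mD∁E λ (d , ¬e) → miss d ¬e) ⟩
      fromℕ c * ℙ mDE + fromℕ c * ℙ mD∁E                        ≈⟨ distribˡ (fromℕ c) _ _ ⟨
      fromℕ c * (ℙ mDE + ℙ mD∁E)                                ≈⟨ *-congˡ (ℙ-split mD (mE i)) ⟨
      fromℕ c * ℙ mD                                            ∎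
      where
      mDE = mD ∩ᵐ mE i
      mD∁E = mD ∩ᵐ complement (mE i)
      miss : ∀ {s} → D s → ¬ E i s → length (filter (E? s) is) ≡ c
      miss {s} d ¬e = ≡.trans (≡.cong length (≡.sym (filter-reject (E? s) ¬e))) (count d)
      hit : ∀ c → (∀ {s} → D s → length (filter (E? s) (i ∷ is)) ≡ c) → ℙ mDE + total is mDE ≈ fromℕ c * ℙ mDE
      -- With count 0 the event of the head cannot occur within `D`.
      hit zero    count = begin-equality
        ℙ mDE + total is mDE ≈⟨ +-cong (ℙ-empty mDE ¬DE) (total-empty is mDE ¬DE) ⟩
        0# + 0#              ≈⟨ +-identityˡ 0# ⟩
        0#                   ≈⟨ zeroˡ _ ⟨
        0# * ℙ mDE           ∎
        where
        ¬DE : Empty (D ∩ E i)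
        ¬DE s (d , e) = contradiction (≡.trans (≡.sym (≡.cong length (filter-accept (E? s) {xs = is} e))) (count d)) λ ()
      hit (suc c) count = begin-equality
        ℙ mDE + total is mDE           ≈⟨ +-cong (sym (*-identityˡ _)) (total-count E? is c mDE λ (d , e) → ℕ.suc-injective
                                            (≡.trans (≡.sym (≡.cong length (filter-accept (E? _) e))) (count d))) ⟩
        1# * ℙ mDE + fromℕ c * ℙ mDE   ≈⟨ distribʳ _ 1# (fromℕ c) ⟨
        fromℕ (suc c) * ℙ mDE          ∎

-- The probability of the chain event

module OrderStatisticsLaw (em : ∀ {ℓ} → ExcludedMiddle ℓ) (ℝ : CompleteOrderedField) {u} (𝒫 : ProbabilitySpace ℝ u)
                          (Ω : OrderedMeasurableSpace u) {m n k : ℕ} (l : ℕ) (k≤m : k ℕ.≤ m) (k≤n : k ℕ.≤ n) where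

  private
    module ℝ = CompleteOrderedField ℝ
    module 𝒫 = ProbabilitySpace 𝒫
    module Ω = OrderedMeasurableSpace Ω
    O = Ω.strictTotalOrder
  open RealProperties ℝ using (fromℕ≉0; module ≤-Reasoning)
  open ProbabilityProperties em ℝ 𝒫
  open MeasurableSets em 𝒫.σ-algebra
  open OrderStatistics O
  open CylinderSets em Ω
  open JointLaws em ℝ 𝒫 Ω

  Chain : Pred (Vector Ω.Carrier (m ℕ.+ n)) u
  Chain z = Lift u (countBelow O k k≤m k≤n (z ∘ (_↑ˡ n)) (z ∘ (m ↑ʳ_)) ≡ l)

  Chain-generated : Generated (Cylinder Ω (m ℕ.+ n)) Chain
  Chain-generated = countBelow-measurable k k≤m k≤n (_↑ˡ n) (m ↑ʳ_) (λ c → Lift u (c ≡ l))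

  Chain-measurable : ∀ Z → 𝒫.Measurable (Chain ∘ joint Z)
  Chain-measurable Z = preimage-measurable 𝒫.σ-algebra (joint-measurable Z) Chain-generated

  -- The chain event for the sample rearranged along `p` is the statement about the split of the
  -- original values by `p`.
  countBelow-placement : ∀ (p : Path m n) (z : Vector Ω.Carrier (m ℕ.+ n)) →
    countBelow O k k≤m k≤n (z ∘ (placement p ⟨$⟩ʳ_) ∘ (_↑ˡ n)) (z ∘ (placement p ⟨$⟩ʳ_) ∘ (m ↑ʳ_)) ≡
    numberBelow k (dealX p (tabulate z)) (dealY p (tabulate z))
  countBelow-placement p z = ≡.trans (countBelow≡numberBelow k≤m k≤n _ _)
    (≡.cong₂ (numberBelow k) (placement-X p z) (placement-Y p z))

  module _ {Z : Vector (RandomVariable 𝒫 Ω) (m ℕ.+ n)} (continuous : ∀ i → Continuous (Z i))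
           (independent : Independent Z) (identical : IdenticallyDistributed Z) where

    private
      distinct = distinct-almostSure {Z = Z} continuous independent
      q = ℙ (Chain-measurable Z)

      ChainAt : Path m n → Pred 𝒫.Outcome u
      ChainAt p = Chain ∘ joint (Z ∘ (placement p ⟨$⟩ʳ_))

      mChain : ∀ p → 𝒫.Measurable (ChainAt p)
      mChain p = Chain-measurable (Z ∘ (placement p ⟨$⟩ʳ_))

    open DoubleCounting em ℝ 𝒫

    ℙ-Chain : q ℝ.* ℝ.fromℕ ((m ℕ.+ n) C m) ℝ.≈ ℝ.fromℕ (#paths m n k l)
    ℙ-Chain = begin-equality
      q ℝ.* ℝ.fromℕ ((m ℕ.+ n) C m)                     ≡⟨ ≡.cong (λ c → q ℝ.* ℝ.fromℕ c) (length-paths m n) ⟨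
      q ℝ.* ℝ.fromℕ (length (paths m n))                ≈⟨ ℝ.*-comm q (ℝ.fromℕ (length (paths m n))) ⟩
      ℝ.fromℕ (length (paths m n)) ℝ.* q
        ≈⟨ total-constant {E = ChainAt} mChain (paths m n) mDistinct same ⟨
      total {E = ChainAt} mChain (paths m n) mDistinct
        ≈⟨ total-count {E = ChainAt} mChain Chain? (paths m n) (#paths m n k l) mDistinct hits ⟩
      ℝ.fromℕ (#paths m n k l) ℝ.* ℙ mDistinct          ≈⟨ ℝ.*-congˡ (proj₂ distinct) ⟩
      ℝ.fromℕ (#paths m n k l) ℝ.* ℝ.1#                 ≈⟨ ℝ.*-identityʳ _ ⟩
      ℝ.fromℕ (#paths m n k l)                          ∎
      where
      open ≤-Reasoning
      mDistinct = proj₁ distinct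
      -- Distinctness is imposed because the count of successful splits is known only there; being
      -- almost sure, it leaves the common probability unchanged.
      same : ∀ p → ℙ (mDistinct ∩ᵐ mChain p) ℝ.≈ q
      same p = begin-equality
        ℙ (mDistinct ∩ᵐ mChain p)  ≈⟨ 𝒫.Pr-cong (swap , swap) (mDistinct ∩ᵐ mChain p) (mChain p ∩ᵐ mDistinct) ⟩
        ℙ (mChain p ∩ᵐ mDistinct)  ≈⟨ ℙ-∩-almostSure (mChain p) distinct ⟩
        ℙ (mChain p)
          ≈⟨ exchangeable {Z = Z} independent identical (placement p) Chain-generated (mChain p) (Chain-measurable Z) ⟩
        q                          ∎
      Chain? : ∀ s → Decidable (λ p → ChainAt p s)
      Chain? s p = em
      hits : ∀ {s} → Distinct Z s → length (filter (Chain? s) (paths m n)) ≡ #paths m n k l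
      hits {s} ≉ = ≡.trans
        (≡.cong length (filter-≐ (Chain? s) (λ p → numberBelow k (dealX p zs) (dealY p zs) ℕ.≟ l)
          ( (λ {p} e → ≡.trans (≡.sym (countBelow-placement p z)) (lower e))
          , (λ {p} e → lift (≡.trans (countBelow-placement p z) e)))
          (paths m n)))
        (deal-count m n k l zs (length-tabulate z) (AllPairs.tabulate⁺ λ i≢j → ≉ _ _ i≢j))
        where
        z = joint Z s
        zs = tabulate z

    ℙ-Chain-/ : q ℝ.≈ ℝ.fromℕ (#paths m n k l) ℝ./ ℝ.fromℕ ((m ℕ.+ n) C m)
    ℙ-Chain-/ = begin-equality
      q                                     ≈⟨ ℝ.*-identityʳ q ⟨
      q ℝ.* ℝ.1#                            ≈⟨ ℝ.*-congˡ (ℝ.⁻¹-inverseʳ c≉0) ⟨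
      q ℝ.* (c ℝ.* c ℝ.⁻¹)                  ≈⟨ ℝ.*-assoc q c (c ℝ.⁻¹) ⟨
      q ℝ.* c ℝ.* c ℝ.⁻¹                    ≈⟨ ℝ.*-congʳ ℙ-Chain ⟩
      ℝ.fromℕ (#paths m n k l) ℝ./ c        ∎
      where
      open ≤-Reasoning
      c = ℝ.fromℕ ((m ℕ.+ n) C m)
      c≉0 : c ℝ.≉ ℝ.0#
      c≉0 = ≡.subst (λ c → ℝ.fromℕ c ℝ.≉ ℝ.0#) (length-paths m n) (fromℕ≉0 (∈-length (paths-complete (somePath m n))))

open import Data.Nat.Base using (_+_; _≤_)
open import Data.Nat.Properties using (≤-trans)

theorem3p4 :
    (∀ {ℓ} → ExcludedMiddle ℓ) →
    ∀ {u} (ℝ : CompleteOrderedField) (𝒫 : ProbabilitySpace ℝ u) (Ω : OrderedMeasurableSpace u) →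
    let module ℝ = CompleteOrderedField ℝ
        module 𝒫 = ProbabilitySpace 𝒫 in
    ∀ (m n k l : ℕ) → l ≤ k → (k≤m : k ≤ m) (m≤n : m ≤ n) → 1 ≤ m →
    ∀ (X : Vector (RandomVariable 𝒫 Ω) m) (Y : Vector (RandomVariable 𝒫 Ω) n) →
    (∀ i → Continuous ((X ++ Y) i)) →
    Independent (X ++ Y) →
    IdenticallyDistributed (X ++ Y) →
    let E = ChainBelow k l k≤m (≤-trans k≤m m≤n) X Y in
    Σ[ mE ∈ 𝒫.Measurable E ] 𝒫.Pr E mE ℝ.≈ ℝ.fromℕ (#paths m n k l) ℝ./ ℝ.fromℕ ((m + n) C m)
theorem3p4 em {u} ℝ 𝒫 Ω m n k l _ k≤m m≤n _ X Y continuous independent identical =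
  𝒫.resp Chain≐ (Chain-measurable (X ++ Y)) ,
  ℝ.trans (𝒫.Pr-cong (proj₂ Chain≐ , proj₁ Chain≐) _ _) (ℙ-Chain-/ {Z = X ++ Y} continuous independent identical)
  where
  module ℝ = CompleteOrderedField ℝ
  module 𝒫 = ProbabilitySpace 𝒫
  O = OrderedMeasurableSpace.strictTotalOrder Ω
  k≤n = ≤-trans k≤m m≤n
  open OrderStatistics O using (numberBelow; countBelow≡numberBelow)
  open OrderStatisticsLaw em ℝ 𝒫 Ω {m} {n} {k} l k≤m k≤n
  open JointLaws em ℝ 𝒫 Ω using (joint)
  -- The halves of `X ++ Y` agree with `X` and `Y` only pointwise. Passing to `numberBelow` reduces
  -- the comparison to tabulated lists, where pointwise equality suffices.
  same-count : ∀ s → countBelow O k k≤m k≤n (joint (X ++ Y) s ∘ (_↑ˡ n)) (joint (X ++ Y) s ∘ (m ↑ʳ_)) ≡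
                     countBelow O k k≤m k≤n (λ i → value (X i) s) (λ j → value (Y j) s)
  same-count s = ≡.trans (countBelow≡numberBelow k≤m k≤n _ _) (≡.trans
    (≡.cong₂ (numberBelow k)
      (tabulate-cong λ i → ≡.cong (λ V → value V s) (lookup-++ˡ X Y i))
      (tabulate-cong λ j → ≡.cong (λ V → value V s) (lookup-++ʳ X Y j)))
    (≡.sym (countBelow≡numberBelow k≤m k≤n _ _)))
  Chain≐ : (Chain ∘ joint (X ++ Y)) ≐ ChainBelow k l k≤m k≤n X Y
  Chain≐ = (λ {s} e → lift (≡.trans (≡.sym (same-count s)) (lower e))) ,
           (λ {s} e → lift (≡.trans (same-count s) (lower e)))
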